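{- Let $0<\alpha\le 1$ and let $\mathcal F$ be a $k$-uniform hypergraph with $n$ vertices and $|\mathcal F|=n^r$ edges, where $r\ge 1$. If $$\wp(\mathcal F,\alpha n)\le\min\Big\{\binom{x}{k-\lceil r\rceil}n,\ \tfrac12|\mathcal F|\Big\}$$ for some real $x\ge 2k$, then for every integer $i$ with $r+1\le i\le k$, $$\Big|\binom{\mathcal F}{i}\Big|\ge\frac1C\cdot\frac{\binom{x}{i}}{\binom{x}{k}}\,|\mathcal F|,\qquad C=(8k/\alpha)^{\lceil 5r\rceil}\log n .$$
   Context: For real $y$ and integer $i\ge0$, $\binom{y}{i}=\frac{y(y-1)\cdots(y-i+1)}{i!}$. For a hypergraph $\mathcal F$ and integer $i$, $\binom{\mathcal F}{i}=\{S: |S|=i\text{ and }S\subseteq e\text{ for some }e\in\mathcal F\}$. For a hypergraph $\mathcal F$ on vertex set $V$ and integer $i$, $\wp(\mathcal F,i)=\max_{I\subseteq V,|I|=i}|\{e\in\mathcal F: e\subseteq I\}|$, the maximum number of edges induced on $i$ vertices. Logarithms are base $2$; floors (e.g. of $\alpha n$) are omitted.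
   Formalization: The numbers α and x, real in the statement, are taken to be rational; r remains an arbitrary real, determined by |F| = n^r, and αn is rounded down. -}

module Defs where

open import Data.Bool using (Bool; true; false)
open import Data.Nat as ℕ using (ℕ; zero; suc; _⊔_)
open import Data.Integer as ℤ using (ℤ; +_)
open import Data.Rational as ℚ using (ℚ; 0ℚ; 1ℚ; _*_; _-_; _/_)
open import Data.List using (List; []; _∷_; length; filter; map; _++_; foldr)
open import Data.List.Relation.Unary.Any using (any?)
open import Data.Fin.Subset using (Subset; _⊆_; ∣_∣; inside; outside)
open import Data.Fin.Subset.Properties using (_⊆?_)
open import Data.Vec using (_∷_; [])
open import Data.Nat.Properties using (_≟_)
open import Relation.Nullary.Decidable using (_×-dec_)

ℕ→ℚ : ℕ → ℚ
ℕ→ℚ m = (+ m) / 1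

_^ℚ_ : ℚ → ℕ → ℚ
q ^ℚ zero  = 1ℚ
q ^ℚ suc m = q * (q ^ℚ m)

binomQ : ℚ → ℕ → ℚ
binomQ y zero    = 1ℚ
binomQ y (suc i) = binomQ y i * (y - ℕ→ℚ i) * ((+ 1) / suc i)

allSubsets : (n : ℕ) → List (Subset n)
allSubsets zero    = [] ∷ []
allSubsets (suc n) = map (outside ∷_) (allSubsets n) ++ map (inside ∷_) (allSubsets n)

-- A hypergraph on vertex set Fin n is given by its list of edges
-- (distinctness and uniformity are imposed as hypotheses in the statement).
Hypergraph : ℕ → Set
Hypergraph n = List (Subset n)

shadowSize : {n : ℕ} → Hypergraph n → ℕ → ℕ
shadowSize {n} F i =
  length (filter (λ S → (∣ S ∣ ≟ i) ×-dec any? (λ e → S ⊆? e) F) (allSubsets n))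

inducedEdges : {n : ℕ} → Hypergraph n → Subset n → ℕ
inducedEdges F I = length (filter (λ e → e ⊆? I) F)

wp : {n : ℕ} → Hypergraph n → ℕ → ℕ
wp {n} F m = foldr _⊔_ 0 (map (inducedEdges F) (filter (λ I → ∣ I ∣ ≟ m) (allSubsets n)))

-- "b ≤ a · log₂ n" (for a ≥ 0), expressed without reals:
-- for every rational u/v with log₂ n ≤ u/v (i.e. n^v ≤ 2^u), b ≤ a · u/v.
LeTimesLog2 : ℕ → ℚ → ℚ → Set
LeTimesLog2 n a b = (u w : ℕ) → n ℕ.^ suc w ℕ.≤ 2 ℕ.^ u → b ℚ.≤ a * ((+ u) / suc w)

{-# OPTIONS --safe #-}
module Submission where

-- Write c = ⌈r⌉, m = ⌊αn⌋ and B = C(x, k-c). Call a set S of at most c vertices fat if its degree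
-- exceeds (4kn/m)^|S| B n^(c-|S|). Counting degrees, a set S that is not fat has at most m/4 fat
-- one-vertex extensions; since m vertices span at most Bn edges, for 0 < |S| < c-1 at most half of
-- the edges through S consist of fat extensions only. For |S| = c-1 this may fail, but the union of
-- all such bad sets has at most m/2 vertices: otherwise the bad sets, together with their fat
-- extensions, would contain m vertices spanning more than Bn edges. As m vertices span at most half
-- of F, one can start outside the bad vertices and the fat singletons and extend, losing a factor 2
-- in each step, to c-sets that are not fat. The link of such a set has at most (4kn/m)^c C(x, k-c)
-- edges, so Lovász's form of the Kruskal–Katona theorem bounds its shadow from below, and the
-- shadows of the links add up to the shadow of F.

-- A fat neighbour of S forces deg S above (4kn/m)^(|S|+1) B n^(c-|S|-1). For |S| < c-1 this beats
-- the sparsity bound Bn, but for |S| = c-1 no free factor n is left, which is why only that size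
-- needs a collective argument. At the end of the descent no real parameter is solved for in
-- Lovász's theorem. If the i-shadow of a link is below C(N, i-c), a linear form of the theorem
-- makes degree and shadow proportional; otherwise the shadow is large by itself and non-fatness
-- bounds the degree. This works with a natural number N, so x is rounded up to some N ≤ x + 1, at
-- the cost of a factor 2. The total loss is (32 k^3 n/m)^c: per level 2k from trading C(N,
-- i-c)/C(N, k-c) for C(N, i)/C(N, k), 2i from the descent, 4kn/m from fatness, and 2 to cover the
-- rounding. Its base is at most (8k/α)^3, and 3⌈r⌉ ≤ ⌈5r⌉ because r ≥ 1.

module Combinatorics where

  open import Defs
  import Data.Bool as Bool
  open import Data.Bool using (if_then_else_)
  open import Data.Empty using (⊥-elim)
  open import Data.Fin using (Fin; zero; suc)
  open import Data.Fin.Properties using (any?)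
  open import Data.Fin.Subset using (Subset; inside; outside; _∈_; _∉_; _⊆_; _∪_; _-_; _─_; ⁅_⁆; ∣_∣; ⋃) renaming (⊥ to ∅; ⊤ to full)
  open import Data.Fin.Subset.Properties
  open import Data.List using (List; []; _∷_; _++_; map; length; filter; foldr; allFin)
  open import Data.List.Membership.Propositional using () renaming (_∈_ to _∈ˡ_)
  open import Data.List.Membership.Propositional.Properties using (∈-++⁺ˡ; ∈-++⁺ʳ; ∈-map⁺; ∈-filter⁺; ∈-allFin)
  open import Data.List.Properties using (map-tabulate)
  open import Data.List.Relation.Unary.All as All using (All; []; _∷_)
  import Data.List.Relation.Unary.All.Properties as All
  open import Data.List.Relation.Unary.AllPairs using ([]; _∷_)
  open import Data.List.Relation.Unary.Any as Any using (Any; here; there)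
  open import Data.List.Relation.Unary.Unique.Propositional using (Unique)
  open import Data.Nat as ℕ using (ℕ; zero; suc; _+_; _*_; _∸_; _^_; _⊔_; _≤_; _<_; z≤n; s≤s; _≟_; _<?_; NonZero; >-nonZero)
  open import Data.Nat.Combinatorics using (_C_; nCk+nC[k+1]≡[n+1]C[k+1]; k>n⇒nCk≡0)
  open import Data.Nat.Properties hiding (_≟_; _<?_)
  open import Data.Nat.Tactic.RingSolver using (solve-∀)
  open import Data.Product using (∃; _×_; _,_; proj₁; proj₂)
  open import Data.Sum using (inj₁; inj₂)
  open import Data.Vec using ([]; _∷_; here; there; tabulate)
  open import Data.Vec.Properties using (lookup⇒[]=; []=⇒lookup; lookup∘tabulate; ≡-dec; ∷-injectiveʳ)
  open import Function using (_∘_)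
  open import Level using (Level)
  open import Relation.Binary.PropositionalEquality using (_≡_; refl; sym; trans; cong; cong₂; subst; module ≡-Reasoning)
  open import Relation.Nullary using (Dec; yes; no; ¬_; does)
  open import Relation.Nullary.Decidable using (_×-dec_; ¬?; dec-true)

  private variable
    ℓ ℓ′ : Level
    A A′ : Set ℓ
    P Q : Set ℓ
    n : ℕ

  -- Finite sums and indicators

  ∑ : List A → (A → ℕ) → ℕ
  ∑ []       f = 0
  ∑ (x ∷ xs) f = f x + ∑ xs f

  ∑-cong : ∀ (xs : List A) {f g} → (∀ x → f x ≡ g x) → ∑ xs f ≡ ∑ xs g
  ∑-cong []       eq = refl
  ∑-cong (x ∷ xs) eq = cong₂ _+_ (eq x) (∑-cong xs eq)

  ∑-mono-All : ∀ {xs : List A} {f g} → All (λ x → f x ≤ g x) xs → ∑ xs f ≤ ∑ xs g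
  ∑-mono-All []         = z≤n
  ∑-mono-All (le ∷ les) = +-mono-≤ le (∑-mono-All les)

  ∑-mono : ∀ (xs : List A) {f g} → (∀ x → f x ≤ g x) → ∑ xs f ≤ ∑ xs g
  ∑-mono xs le = ∑-mono-All (All.universal le xs)

  ∑-zero : ∀ (xs : List A) → ∑ xs (λ _ → 0) ≡ 0
  ∑-zero []       = refl
  ∑-zero (x ∷ xs) = ∑-zero xs

  ∑-+ : ∀ (xs : List A) f g → ∑ xs (λ x → f x + g x) ≡ ∑ xs f + ∑ xs g
  ∑-+ []       f g = refl
  ∑-+ (x ∷ xs) f g rewrite ∑-+ xs f g = interchange (f x) (g x) (∑ xs f) (∑ xs g)
    where
    interchange : ∀ a b c d → a + b + (c + d) ≡ a + c + (b + d)
    interchange = solve-∀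

  ∑-*ˡ : ∀ (xs : List A) c f → ∑ xs (λ x → c * f x) ≡ c * ∑ xs f
  ∑-*ˡ []       c f = sym (*-zeroʳ c)
  ∑-*ˡ (x ∷ xs) c f rewrite ∑-*ˡ xs c f = sym (*-distribˡ-+ c (f x) (∑ xs f))

  ∑-*ʳ : ∀ (xs : List A) c f → ∑ xs (λ x → f x * c) ≡ ∑ xs f * c
  ∑-*ʳ xs c f = trans (∑-cong xs (λ x → *-comm (f x) c)) (trans (∑-*ˡ xs c f) (*-comm c _))

  ∑-swap : ∀ (xs : List A) (ys : List A′) (f : A → A′ → ℕ) →
           ∑ xs (λ x → ∑ ys (f x)) ≡ ∑ ys (λ y → ∑ xs (λ x → f x y))
  ∑-swap []       ys f = sym (∑-zero ys)
  ∑-swap (x ∷ xs) ys f = trans (cong (∑ ys (f x) +_) (∑-swap xs ys f))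
                               (sym (∑-+ ys (f x) (λ y → ∑ xs (λ x → f x y))))

  ∑-++ : ∀ (xs ys : List A) f → ∑ (xs ++ ys) f ≡ ∑ xs f + ∑ ys f
  ∑-++ []       ys f = refl
  ∑-++ (x ∷ xs) ys f rewrite ∑-++ xs ys f = sym (+-assoc (f x) _ _)

  ∑-map : ∀ (h : A → A′) (xs : List A) f → ∑ (map h xs) f ≡ ∑ xs (f ∘ h)
  ∑-map h []       f = refl
  ∑-map h (x ∷ xs) f = cong (f (h x) +_) (∑-map h xs f)

  ∑-member : ∀ {xs : List A} {x} f → x ∈ˡ xs → f x ≤ ∑ xs f
  ∑-member f (here refl)            = m≤m+n _ _
  ∑-member {xs = y ∷ _} f (there x∈) = ≤-trans (∑-member f x∈) (m≤n+m _ (f y))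

  -- Only the Boolean of the decision is read, so `𝟙 (suc v ∈? (b ∷ S))` reduces to `𝟙 (v ∈? S)` and
  -- recursions over vectors go through by computation.
  𝟙 : Dec P → ℕ
  𝟙 P? = if does P? then 1 else 0

  𝟙-yes : (P? : Dec P) → P → 𝟙 P? ≡ 1
  𝟙-yes (yes _) _ = refl
  𝟙-yes (no ¬p) p = ⊥-elim (¬p p)

  𝟙-no : (P? : Dec P) → ¬ P → 𝟙 P? ≡ 0
  𝟙-no (yes p) ¬p = ⊥-elim (¬p p)
  𝟙-no (no _)  _  = refl

  𝟙-mono : (P? : Dec P) (Q? : Dec Q) → (P → Q) → 𝟙 P? ≤ 𝟙 Q?
  𝟙-mono (no _)  Q? f = z≤n
  𝟙-mono (yes p) Q? f = ≤-reflexive (sym (𝟙-yes Q? (f p)))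

  𝟙-cong : (P? : Dec P) (Q? : Dec Q) → (P → Q) → (Q → P) → 𝟙 P? ≡ 𝟙 Q?
  𝟙-cong P? Q? f g = ≤-antisym (𝟙-mono P? Q? f) (𝟙-mono Q? P? g)

  𝟙-× : (P? : Dec P) (Q? : Dec Q) → 𝟙 (P? ×-dec Q?) ≡ 𝟙 P? * 𝟙 Q?
  𝟙-× (no _)  Q?      = refl
  𝟙-× (yes _) (no _)  = refl
  𝟙-× (yes _) (yes _) = refl

  𝟙-pos : (P? : Dec P) → 0 < 𝟙 P? → P
  𝟙-pos (yes p) _ = p

  length-filter : ∀ {P : A → Set ℓ′} (P? : ∀ x → Dec (P x)) (xs : List A) →
                  length (filter P? xs) ≡ ∑ xs (λ x → 𝟙 (P? x))
  length-filter P? []       = refl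
  length-filter P? (x ∷ xs) with P? x
  ... | yes _ = cong suc (length-filter P? xs)
  ... | no _  = length-filter P? xs

  ∑-pos : ∀ (xs : List A) f → 0 < ∑ xs f → ∃ λ x → x ∈ˡ xs × 0 < f x
  ∑-pos (x ∷ xs) f lt with f x in eq
  ... | suc _ = x , here refl , subst (0 <_) (sym eq) (s≤s z≤n)
  ... | zero  = let y , y∈ , fy = ∑-pos xs f lt in y , there y∈ , fy

  ∑-allFin-suc : ∀ (f : Fin (suc n) → ℕ) →
                 ∑ (allFin (suc n)) f ≡ f zero + ∑ (allFin n) (f ∘ suc)
  ∑-allFin-suc f = cong (f zero +_)
    (trans (cong (λ xs → ∑ xs f) (sym (map-tabulate (λ i → i) suc))) (∑-map suc (allFin _) f))

  -- Subsets of a finite set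

  ∈-allSubsets : (S : Subset n) → S ∈ˡ allSubsets n
  ∈-allSubsets []            = here refl
  ∈-allSubsets (outside ∷ S) = ∈-++⁺ˡ (∈-map⁺ (outside ∷_) (∈-allSubsets S))
  ∈-allSubsets (inside ∷ S)  = ∈-++⁺ʳ (map (outside ∷_) (allSubsets _)) (∈-map⁺ (inside ∷_) (∈-allSubsets S))

  ∑-allSubsets-suc : ∀ (f : Subset (suc n) → ℕ) → ∑ (allSubsets (suc n)) f ≡
    ∑ (allSubsets n) (f ∘ (outside ∷_)) + ∑ (allSubsets n) (f ∘ (inside ∷_))
  ∑-allSubsets-suc {n} f = trans (∑-++ (map (outside ∷_) (allSubsets n)) _ f)
    (cong₂ _+_ (∑-map (outside ∷_) (allSubsets n) f) (∑-map (inside ∷_) (allSubsets n) f))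

  ∣p∣≡∑ : (S : Subset n) → ∣ S ∣ ≡ ∑ (allFin n) (λ v → 𝟙 (v ∈? S))
  ∣p∣≡∑ []            = refl
  ∣p∣≡∑ (inside ∷ S)  = trans (cong suc (∣p∣≡∑ S)) (sym (∑-allFin-suc (λ v → 𝟙 (v ∈? (inside ∷ S)))))
  ∣p∣≡∑ (outside ∷ S) = trans (∣p∣≡∑ S) (sym (∑-allFin-suc (λ v → 𝟙 (v ∈? (outside ∷ S)))))

  ∣p∪q∣≤∣p∣+∣q∣ : (S T : Subset n) → ∣ S ∪ T ∣ ≤ ∣ S ∣ + ∣ T ∣
  ∣p∪q∣≤∣p∣+∣q∣ []            []            = z≤n
  ∣p∪q∣≤∣p∣+∣q∣ (inside ∷ S)  (inside ∷ T)  = s≤s (≤-trans (∣p∪q∣≤∣p∣+∣q∣ S T) (+-monoʳ-≤ ∣ S ∣ (n≤1+n _)))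
  ∣p∪q∣≤∣p∣+∣q∣ (inside ∷ S)  (outside ∷ T) = s≤s (∣p∪q∣≤∣p∣+∣q∣ S T)
  ∣p∪q∣≤∣p∣+∣q∣ (outside ∷ S) (inside ∷ T)  rewrite +-suc ∣ S ∣ ∣ T ∣ = s≤s (∣p∪q∣≤∣p∣+∣q∣ S T)
  ∣p∪q∣≤∣p∣+∣q∣ (outside ∷ S) (outside ∷ T) = ∣p∪q∣≤∣p∣+∣q∣ S T

  ∣p∪⁅x⁆∣≡1+∣p∣ : ∀ {v} {S : Subset n} → v ∉ S → ∣ S ∪ ⁅ v ⁆ ∣ ≡ suc ∣ S ∣
  ∣p∪⁅x⁆∣≡1+∣p∣ {v = zero}  {inside ∷ S}  v∉S = ⊥-elim (v∉S here)
  ∣p∪⁅x⁆∣≡1+∣p∣ {v = zero}  {outside ∷ S} v∉S = cong (suc ∘ ∣_∣) (∪-identityʳ S)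
  ∣p∪⁅x⁆∣≡1+∣p∣ {v = suc v} {inside ∷ S}  v∉S = cong suc (∣p∪⁅x⁆∣≡1+∣p∣ (v∉S ∘ there))
  ∣p∪⁅x⁆∣≡1+∣p∣ {v = suc v} {outside ∷ S} v∉S = ∣p∪⁅x⁆∣≡1+∣p∣ (v∉S ∘ there)

  1+∣p-x∣≡∣p∣ : ∀ {v} {S : Subset n} → v ∈ S → suc ∣ S - v ∣ ≡ ∣ S ∣
  1+∣p-x∣≡∣p∣ {v = zero}  {inside ∷ S}  here        = cong (suc ∘ ∣_∣) (p─⊥≡p S)
  1+∣p-x∣≡∣p∣ {v = suc v} {inside ∷ S}  (there v∈S) = cong suc (1+∣p-x∣≡∣p∣ v∈S)
  1+∣p-x∣≡∣p∣ {v = suc v} {outside ∷ S} (there v∈S) = 1+∣p-x∣≡∣p∣ v∈S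

  p∪⁅x⁆⊆q⁺ : ∀ {v} {S T : Subset n} → S ⊆ T → v ∈ T → S ∪ ⁅ v ⁆ ⊆ T
  p∪⁅x⁆⊆q⁺ {v = v} {S} S⊆T v∈T x∈ with x∈p∪q⁻ S ⁅ v ⁆ x∈
  ... | inj₁ x∈S = S⊆T x∈S
  ... | inj₂ x∈v rewrite x∈⁅y⁆⇒x≡y v x∈v = v∈T

  p∪⁅x⁆⊆q⁻ : ∀ {v} {S T : Subset n} → S ∪ ⁅ v ⁆ ⊆ T → S ⊆ T × v ∈ T
  p∪⁅x⁆⊆q⁻ {v = v} {S} S+v⊆T = (λ x∈S → S+v⊆T (x∈p∪q⁺ (inj₁ x∈S))) , S+v⊆T (x∈p∪q⁺ (inj₂ (x∈⁅x⁆ v)))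

  -- The map `A ↦ A - v` is a bijection from the sets that contain v to those that avoid it.
  ∑-delete : ∀ (v : Fin n) (g : Subset n → ℕ) →
    ∑ (allSubsets n) (λ A → 𝟙 (v ∈? A) * g (A - v)) ≡ ∑ (allSubsets n) (λ A → 𝟙 (¬? (v ∈? A)) * g A)
  ∑-delete {suc n} zero g = begin
    ∑ (allSubsets (suc n)) (λ A → 𝟙 (zero ∈? A) * g (A - zero))
      ≡⟨ ∑-allSubsets-suc (λ A → 𝟙 (zero ∈? A) * g (A - zero)) ⟩
    ∑ Ω (λ _ → 0) + ∑ Ω (λ A → g (outside ∷ (A ─ ∅)) + 0)
      ≡⟨ cong₂ _+_ (∑-zero Ω) (∑-cong Ω (λ A → cong (λ B → g (outside ∷ B) + 0) (p─⊥≡p A))) ⟩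
    ∑ Ω (λ A → g (outside ∷ A) + 0)
      ≡⟨ sym (+-identityʳ _) ⟩
    ∑ Ω (λ A → g (outside ∷ A) + 0) + 0
      ≡⟨ cong (∑ Ω (λ A → g (outside ∷ A) + 0) +_) (sym (∑-zero Ω)) ⟩
    ∑ Ω (λ A → g (outside ∷ A) + 0) + ∑ Ω (λ _ → 0)
      ≡⟨ sym (∑-allSubsets-suc (λ A → 𝟙 (¬? (zero ∈? A)) * g A)) ⟩
    ∑ (allSubsets (suc n)) (λ A → 𝟙 (¬? (zero ∈? A)) * g A) ∎
    where open ≡-Reasoning
          Ω = allSubsets n
  ∑-delete {suc n} (suc v) g =
    trans (∑-allSubsets-suc (λ A → 𝟙 (suc v ∈? A) * g (A - suc v)))
    (trans (cong₂ _+_ (∑-delete v (g ∘ (outside ∷_))) (∑-delete v (g ∘ (inside ∷_))))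
    (sym (∑-allSubsets-suc (λ A → 𝟙 (¬? (suc v ∈? A)) * g A))))

  -- Greedy choice: an element of T outside S is skipped while the rest of T still supplies t
  -- elements, and taken otherwise. This pads a vertex set to exactly m vertices and finds an i-set
  -- inside an edge.
  interpolate : ∀ {S T : Subset n} t → S ⊆ T → ∣ S ∣ ≤ t → t ≤ ∣ T ∣ →
                ∃ λ R → S ⊆ R × R ⊆ T × ∣ R ∣ ≡ t
  interpolate {S = []} {[]} zero S⊆T _ _ = [] , S⊆T , S⊆T , refl
  interpolate {S = outside ∷ S} {outside ∷ T} t S⊆T lo hi =
    let R , S⊆R , R⊆T , eq = interpolate t (drop-∷-⊆ S⊆T) lo hi
    in outside ∷ R , s⊆s S⊆R , s⊆s R⊆T , eq
  interpolate {S = inside ∷ S} {outside ∷ T} t S⊆T lo hi with S⊆T here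
  ... | ()
  interpolate {S = inside ∷ S} {inside ∷ T} (suc t) S⊆T (s≤s lo) (s≤s hi) =
    let R , S⊆R , R⊆T , eq = interpolate t (drop-∷-⊆ S⊆T) lo hi
    in inside ∷ R , s⊆s S⊆R , s⊆s R⊆T , cong suc eq
  interpolate {S = outside ∷ S} {inside ∷ T} t S⊆T lo hi with t ℕ.≤? ∣ T ∣
  ... | yes t≤ =
    let R , S⊆R , R⊆T , eq = interpolate t (drop-∷-⊆ S⊆T) lo t≤
    in outside ∷ R , s⊆s S⊆R , out⊆ R⊆T , eq
  interpolate {S = outside ∷ S} {inside ∷ T} zero S⊆T lo hi | no t≰ = ⊥-elim (t≰ z≤n)
  interpolate {S = outside ∷ S} {inside ∷ T} (suc t) S⊆T lo (s≤s hi) | no t≰ =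
    let T≤t = ≤-pred (≰⇒> t≰)
        R , S⊆R , R⊆T , eq = interpolate t (drop-∷-⊆ S⊆T) (≤-trans (p⊆q⇒∣p∣≤∣q∣ (drop-∷-⊆ S⊆T)) T≤t) hi
    in inside ∷ R , out⊆ S⊆R , s⊆s R⊆T , cong suc eq

  subsetsOfSize : ℕ → Subset n → ℕ
  subsetsOfSize {n} j T = ∑ (allSubsets n) (λ S → 𝟙 ((∣ S ∣ ≟ j) ×-dec (S ⊆? T)))

  -- Splitting at the first element of T gives Pascal's rule, and t^j + t^(j-1) ≤ (t+1)^j for j ≥ 1.
  -- The crude power suffices, as it is absorbed by the powers of k in the threshold.
  subsetsOfSize≤∣p∣^j : ∀ j (T : Subset n) → subsetsOfSize j T ≤ ∣ T ∣ ^ j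
  subsetsOfSize≤∣p∣^j zero    [] = ≤-refl
  subsetsOfSize≤∣p∣^j (suc j) [] = z≤n
  subsetsOfSize≤∣p∣^j {suc n} j (outside ∷ T) = begin
    subsetsOfSize j (outside ∷ T)
      ≡⟨ ∑-allSubsets-suc (λ S → 𝟙 ((∣ S ∣ ≟ j) ×-dec (S ⊆? (outside ∷ T)))) ⟩
    ∑ (allSubsets n) (λ S → 𝟙 ((∣ S ∣ ≟ j) ×-dec ((outside ∷ S) ⊆? (outside ∷ T)))) +
    ∑ (allSubsets n) (λ S → 𝟙 ((suc ∣ S ∣ ≟ j) ×-dec ((inside ∷ S) ⊆? (outside ∷ T))))
      ≤⟨ +-mono-≤ (∑-mono (allSubsets n) (λ S → 𝟙-mono ((∣ S ∣ ≟ j) ×-dec ((outside ∷ S) ⊆? (outside ∷ T)))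
                                                       ((∣ S ∣ ≟ j) ×-dec (S ⊆? T)) λ (eq , le) → eq , drop-∷-⊆ le))
                  (∑-mono (allSubsets n) (λ S → ≤-reflexive (𝟙-no ((suc ∣ S ∣ ≟ j) ×-dec ((inside ∷ S) ⊆? (outside ∷ T)))
                                                                  λ (_ , le) → inside⊈outside le))) ⟩
    subsetsOfSize j T + ∑ (allSubsets n) (λ _ → 0)
      ≡⟨ trans (cong (subsetsOfSize j T +_) (∑-zero (allSubsets n))) (+-identityʳ _) ⟩
    subsetsOfSize j T
      ≤⟨ subsetsOfSize≤∣p∣^j j T ⟩
    ∣ T ∣ ^ j ∎
    where
    open ≤-Reasoning
    inside⊈outside : ∀ {S T : Subset n} → ¬ (inside ∷ S ⊆ outside ∷ T)
    inside⊈outside le with le here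
    ... | ()
  subsetsOfSize≤∣p∣^j {suc n} j (inside ∷ T) = begin
    subsetsOfSize j (inside ∷ T)
      ≡⟨ ∑-allSubsets-suc (λ S → 𝟙 ((∣ S ∣ ≟ j) ×-dec (S ⊆? (inside ∷ T)))) ⟩
    ∑ (allSubsets n) (λ S → 𝟙 ((∣ S ∣ ≟ j) ×-dec ((outside ∷ S) ⊆? (inside ∷ T)))) +
    ∑ (allSubsets n) (λ S → 𝟙 ((suc ∣ S ∣ ≟ j) ×-dec ((inside ∷ S) ⊆? (inside ∷ T))))
      ≤⟨ +-mono-≤ (≤-trans (∑-mono (allSubsets n) (λ S → 𝟙-mono ((∣ S ∣ ≟ j) ×-dec ((outside ∷ S) ⊆? (inside ∷ T)))
                                                                ((∣ S ∣ ≟ j) ×-dec (S ⊆? T)) λ (eq , le) → eq , drop-∷-⊆ le))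
                           (subsetsOfSize≤∣p∣^j j T))
                  (containing j) ⟩
    ∣ T ∣ ^ j + rest j
      ≤⟨ pascal j ⟩
    suc ∣ T ∣ ^ j ∎
    where
    open ≤-Reasoning
    rest : ℕ → ℕ
    rest zero    = 0
    rest (suc j) = ∣ T ∣ ^ j
    containing : ∀ j → ∑ (allSubsets n) (λ S → 𝟙 ((suc ∣ S ∣ ≟ j) ×-dec ((inside ∷ S) ⊆? (inside ∷ T)))) ≤ rest j
    containing zero    = ≤-reflexive (∑-zero (allSubsets n))
    containing (suc j) = ≤-trans
      (∑-mono (allSubsets n) (λ S → 𝟙-mono ((suc ∣ S ∣ ≟ suc j) ×-dec ((inside ∷ S) ⊆? (inside ∷ T)))
                                           ((∣ S ∣ ≟ j) ×-dec (S ⊆? T))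
                                           λ (eq , le) → suc-injective eq , drop-∷-⊆ le))
      (subsetsOfSize≤∣p∣^j j T)
    pascal : ∀ j → ∣ T ∣ ^ j + rest j ≤ suc ∣ T ∣ ^ j
    pascal zero    = ≤-refl
    pascal (suc j) = begin
      ∣ T ∣ * ∣ T ∣ ^ j + ∣ T ∣ ^ j  ≡⟨ +-comm (∣ T ∣ * ∣ T ∣ ^ j) _ ⟩
      suc ∣ T ∣ * ∣ T ∣ ^ j          ≤⟨ *-monoʳ-≤ (suc ∣ T ∣) (^-monoˡ-≤ j (n≤1+n ∣ T ∣)) ⟩
      suc ∣ T ∣ * suc ∣ T ∣ ^ j      ∎

  -- Binomial coefficients

  -- The recursion (k+1) C(n, k+1) = (n-k) C(n, k) with the subtracted term moved to the left, so
  -- that truncated subtraction does not disturb the induction.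
  nC-suc : ∀ n k → suc k * (n C suc k) + k * (n C k) ≡ n * (n C k)
  nC-suc zero    zero    = refl
  nC-suc zero    (suc k) rewrite k>n⇒nCk≡0 {0} {suc (suc k)} (s≤s z≤n) | k>n⇒nCk≡0 {0} {suc k} (s≤s z≤n) =
    cong₂ _+_ (*-zeroʳ k) (*-zeroʳ k)
  nC-suc (suc n) zero rewrite sym (nCk+nC[k+1]≡[n+1]C[k+1] n 0) =
    trans (rearrange (n C 1)) (trans (cong suc (nC-suc n 0)) refl)
    where
    rearrange : ∀ b → 1 * (1 + b) + 0 ≡ 1 + (1 * b + 0 * 1)
    rearrange = solve-∀
  nC-suc (suc n) (suc k)
    rewrite sym (nCk+nC[k+1]≡[n+1]C[k+1] n (suc k)) | sym (nCk+nC[k+1]≡[n+1]C[k+1] n k) = begin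
    suc (suc k) * (b + c) + suc k * (a + b)
      ≡⟨ regroup k a b c ⟩
    (suc (suc k) * c + suc k * b) + b + ((suc k * b + k * a) + a)
      ≡⟨ cong₂ (λ s t → s + b + (t + a)) (nC-suc n (suc k)) (nC-suc n k) ⟩
    n * b + b + (n * a + a)
      ≡⟨ gather n a b ⟩
    suc n * (a + b) ∎
    where
    open ≡-Reasoning
    a = n C k
    b = n C suc k
    c = n C suc (suc k)
    regroup : ∀ k a b c → suc (suc k) * (b + c) + suc k * (a + b) ≡
                          (suc (suc k) * c + suc k * b) + b + ((suc k * b + k * a) + a)
    regroup = solve-∀
    gather : ∀ n a b → n * b + b + (n * a + a) ≡ suc n * (a + b)
    gather = solve-∀

  nC-absorb : ∀ n k → suc k * (suc n C suc k) ≡ suc n * (n C k)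
  nC-absorb n k rewrite sym (nCk+nC[k+1]≡[n+1]C[k+1] n k) = begin
    suc k * (a + b)           ≡⟨ regroup k a b ⟩
    a + (suc k * b + k * a)   ≡⟨ cong (a +_) (nC-suc n k) ⟩
    suc n * a                 ∎
    where
    open ≡-Reasoning
    a = n C k
    b = n C suc k
    regroup : ∀ k a b → suc k * (a + b) ≡ a + (suc k * b + k * a)
    regroup = solve-∀

  nC-step : ∀ {n k} → k ≤ n → suc k * (n C suc k) ≡ (n ∸ k) * (n C k)
  nC-step {n} {k} k≤n = begin
    suc k * (n C suc k)                        ≡⟨ sym (m+n∸n≡m _ (k * (n C k))) ⟩
    suc k * (n C suc k) + k * (n C k) ∸ k * (n C k)   ≡⟨ cong (_∸ k * (n C k)) (nC-suc n k) ⟩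
    n * (n C k) ∸ k * (n C k)                  ≡⟨ sym (*-distribʳ-∸ (n C k) n k) ⟩
    (n ∸ k) * (n C k)                          ∎
    where open ≡-Reasoning

  nC-pos : ∀ {n k} → k ≤ n → 0 < n C k
  nC-pos {n} {zero}  _   = s≤s z≤n
  nC-pos {suc n} {suc k} (s≤s k≤n) rewrite sym (nCk+nC[k+1]≡[n+1]C[k+1] n k) = <-≤-trans (nC-pos k≤n) (m≤m+n _ _)

  -- Sets of a given size in a downset, above a given set

  module Downset {n : ℕ} {D : Subset n → Set} (D? : ∀ A → Dec (D A)) (D-down : ∀ {A B} → A ⊆ B → D B → D A) where

    Ω = allSubsets n
    V = allFin n

    above? : ∀ s S A → Dec (S ⊆ A × (∣ A ∣ ≡ s × D A))
    above? s S A = (S ⊆? A) ×-dec ((∣ A ∣ ≟ s) ×-dec D? A)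

    -- Counts the sets of size s - |S| in the link of S. Sizes are absolute and no link is ever
    -- formed, so an induction can pass from S to `S ∪ ⁅ v ⁆` within the same vertex set.
    d : ℕ → Subset n → ℕ
    d s S = ∑ Ω (λ A → 𝟙 (above? s S A))

    new : Subset n → Fin n → ℕ
    new S v = 𝟙 (¬? (v ∈? S))

    d-mono : ∀ s {S T} → S ⊆ T → d s T ≤ d s S
    d-mono s {S} {T} S⊆T = ∑-mono Ω λ A → 𝟙-mono (above? s T A) (above? s S A)
      λ (T⊆A , rest) → (T⊆A ∘ S⊆T) , rest

    private
      double-count-pointwise : ∀ s S A →
        (S≤A? : Dec (S ⊆ A × (∣ A ∣ ≡ s × D A))) →
        ∑ V (λ v → new S v * 𝟙 (above? s (S ∪ ⁅ v ⁆) A)) + ∣ S ∣ * 𝟙 S≤A? ≡ s * 𝟙 S≤A?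
      double-count-pointwise s S A (no ¬p) = trans (cong₂ _+_
              (trans (∑-cong V (λ v → trans (cong (new S v *_)
                  (𝟙-no (above? s (S ∪ ⁅ v ⁆) A) λ (le , rest) → ¬p (proj₁ (p∪⁅x⁆⊆q⁻ le) , rest)))
                  (*-zeroʳ (new S v)))) (∑-zero V))
              (*-zeroʳ ∣ S ∣)) (sym (*-zeroʳ s))
      double-count-pointwise s S A (yes (S⊆A , ∣A∣≡s , DA)) = begin
        ∑ V f + ∣ S ∣ * 1                       ≡⟨ cong (∑ V f +_) (trans (*-identityʳ _) (∣p∣≡∑ S)) ⟩
        ∑ V f + ∑ V (λ v → 𝟙 (v ∈? S))          ≡⟨ sym (∑-+ V f _) ⟩
        ∑ V (λ v → f v + 𝟙 (v ∈? S))            ≡⟨ ∑-cong V split ⟩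
        ∑ V (λ v → 𝟙 (v ∈? A))                  ≡⟨ sym (∣p∣≡∑ A) ⟩
        ∣ A ∣                                   ≡⟨ trans ∣A∣≡s (sym (*-identityʳ s)) ⟩
        s * 1                                   ∎
        where
        open ≡-Reasoning
        f = λ v → new S v * 𝟙 (above? s (S ∪ ⁅ v ⁆) A)
        split : ∀ v → f v + 𝟙 (v ∈? S) ≡ 𝟙 (v ∈? A)
        split v with v ∈? S
        ... | yes v∈S = sym (𝟙-yes (v ∈? A) (S⊆A v∈S))
        ... | no  _   = trans (+-identityʳ _) (trans (*-identityˡ _)
          (𝟙-cong (above? s (S ∪ ⁅ v ⁆) A) (v ∈? A) (λ (le , _) → proj₂ (p∪⁅x⁆⊆q⁻ le))
                  (λ v∈A → p∪⁅x⁆⊆q⁺ S⊆A v∈A , ∣A∣≡s , DA)))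

    -- Both sides count pairs (v, A) with v in A and A among the sets of `d s S`; the vertices v in
    -- S give the second term. The sum on the left avoids a factor s - |S|.
    double-count : ∀ s S → ∑ V (λ v → new S v * d s (S ∪ ⁅ v ⁆)) + ∣ S ∣ * d s S ≡ s * d s S
    double-count s S = begin
      ∑ V (λ v → new S v * d s (S ∪ ⁅ v ⁆)) + ∣ S ∣ * d s S
        ≡⟨ cong₂ _+_ (trans (∑-cong V (λ v → sym (∑-*ˡ Ω (new S v) _))) (∑-swap V Ω _)) (sym (∑-*ˡ Ω ∣ S ∣ _)) ⟩
      ∑ Ω (λ A → ∑ V (λ v → new S v * 𝟙 (above? s (S ∪ ⁅ v ⁆) A))) + ∑ Ω (λ A → ∣ S ∣ * 𝟙 (above? s S A))
        ≡⟨ sym (∑-+ Ω _ _) ⟩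
      ∑ Ω (λ A → ∑ V (λ v → new S v * 𝟙 (above? s (S ∪ ⁅ v ⁆) A)) + ∣ S ∣ * 𝟙 (above? s S A))
        ≡⟨ ∑-cong Ω (λ A → double-count-pointwise s S A (above? s S A)) ⟩
      ∑ Ω (λ A → s * 𝟙 (above? s S A))
        ≡⟨ ∑-*ˡ Ω s _ ⟩
      s * d s S ∎
      where open ≡-Reasoning

    double-count′ : ∀ j S → ∑ V (λ v → new S v * d (∣ S ∣ + j) (S ∪ ⁅ v ⁆)) ≡ j * d (∣ S ∣ + j) S
    double-count′ j S = +-cancelʳ-≡ (∣ S ∣ * x) _ _
      (trans (double-count (∣ S ∣ + j) S) (trans (*-distribʳ-+ x ∣ S ∣ j) (+-comm (∣ S ∣ * x) (j * x))))
      where x = d (∣ S ∣ + j) S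

    -- A ↦ A - v injects the sets of size s + 1 above S + v into those of size s above S that avoid v.
    d-delete : ∀ s S v → v ∉ S → d (suc s) (S ∪ ⁅ v ⁆) + d s (S ∪ ⁅ v ⁆) ≤ d s S
    d-delete s S v v∉S = begin
      d (suc s) (S ∪ ⁅ v ⁆) + d s (S ∪ ⁅ v ⁆)
        ≤⟨ +-mono-≤ (∑-mono Ω drop) (∑-mono Ω keep) ⟩
      ∑ Ω (λ A → 𝟙 (v ∈? A) * g (A - v)) + ∑ Ω (λ A → 𝟙 (v ∈? A) * g A)
        ≡⟨ cong (_+ ∑ Ω (λ A → 𝟙 (v ∈? A) * g A)) (∑-delete v g) ⟩
      ∑ Ω (λ A → 𝟙 (¬? (v ∈? A)) * g A) + ∑ Ω (λ A → 𝟙 (v ∈? A) * g A)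
        ≡⟨ sym (∑-+ Ω _ _) ⟩
      ∑ Ω (λ A → 𝟙 (¬? (v ∈? A)) * g A + 𝟙 (v ∈? A) * g A)
        ≡⟨ ∑-cong Ω merge ⟩
      d s S ∎
      where
      open ≤-Reasoning
      g = λ A → 𝟙 (above? s S A)
      drop : ∀ A → 𝟙 (above? (suc s) (S ∪ ⁅ v ⁆) A) ≤ 𝟙 (v ∈? A) * g (A - v)
      drop A = ≤-trans (𝟙-mono (above? (suc s) (S ∪ ⁅ v ⁆) A) ((v ∈? A) ×-dec above? s S (A - v))
        λ (le , ∣A∣≡ , DA) → let S⊆A , v∈A = p∪⁅x⁆⊆q⁻ le in
          v∈A , (λ {x} x∈S → x∈p∧x≢y⇒x∈p-y (S⊆A x∈S) (λ { refl → v∉S x∈S }))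
              , suc-injective (trans (1+∣p-x∣≡∣p∣ v∈A) ∣A∣≡) , D-down (p─q⊆p A ⁅ v ⁆) DA)
        (≤-reflexive (𝟙-× (v ∈? A) (above? s S (A - v))))
      keep : ∀ A → 𝟙 (above? s (S ∪ ⁅ v ⁆) A) ≤ 𝟙 (v ∈? A) * g A
      keep A = ≤-trans (𝟙-mono (above? s (S ∪ ⁅ v ⁆) A) ((v ∈? A) ×-dec above? s S A)
        λ (le , rest) → let S⊆A , v∈A = p∪⁅x⁆⊆q⁻ le in v∈A , S⊆A , rest)
        (≤-reflexive (𝟙-× (v ∈? A) (above? s S A)))
      merge : ∀ A → 𝟙 (¬? (v ∈? A)) * g A + 𝟙 (v ∈? A) * g A ≡ g A
      merge A with v ∈? A
      ... | yes _ = +-identityʳ _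
      ... | no  _ = trans (+-identityʳ _) (+-identityʳ _)

    d-pos : ∀ s S {A} → S ⊆ A → ∣ A ∣ ≡ s → D A → 0 < d s S
    d-pos s S {A} S⊆A ∣A∣≡s DA = <-≤-trans
      (≤-reflexive (sym (𝟙-yes (above? s S A) (S⊆A , ∣A∣≡s , DA))))
      (∑-member (λ A → 𝟙 (above? s S A)) (∈-allSubsets A))

    d-pos⁻¹ : ∀ s S → 0 < d s S → ∃ λ A → S ⊆ A × ∣ A ∣ ≡ s × D A
    d-pos⁻¹ s S lt = let A , _ , pos = ∑-pos Ω _ lt in A , 𝟙-pos (above? s S A) pos

    -- Lovász's form of the Kruskal–Katona theorem, linearised: following Keevash, sum over
    -- the links of vertices v, using induction where the link is small and A ↦ A - v elsewhere.
    kruskal-katona-step : ∀ j N S → d (∣ S ∣ + j) S < N C j →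
      suc j * d (∣ S ∣ + suc j) S + j * d (∣ S ∣ + j) S ≤ N * d (∣ S ∣ + j) S
    kruskal-katona-step zero N S small = ≤-trans (≤-reflexive empty) z≤n
      where
      empty : 1 * d (∣ S ∣ + 1) S + 0 ≡ 0
      empty with d (∣ S ∣ + 1) S in eq
      ... | zero  = refl
      ... | suc _ = let A , S⊆A , _ , DA = d-pos⁻¹ (∣ S ∣ + 1) S (subst (0 <_) (sym eq) (s≤s z≤n)) in
        ⊥-elim (<⇒≱ small (d-pos (∣ S ∣ + 0) S (λ x∈ → x∈) (sym (+-identityʳ _)) (D-down S⊆A DA)))
    kruskal-katona-step (suc r) zero    S small =
      ⊥-elim (n≮0 (subst (d (∣ S ∣ + suc r) S <_) (k>n⇒nCk≡0 {0} {suc r} (s≤s z≤n)) small))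
    -- The inequality for each link carries a factor r+1 on the left, and summing `e₁` over the new
    -- vertices gives (r+1) `d₁` on the right; the two cancel.
    kruskal-katona-step (suc r) (suc N) S small = *-cancelˡ-≤ (suc r) (begin
      suc r * (suc (suc r) * d₂ + suc r * d₁)
        ≡⟨ cong₂ (λ a b → suc r * (a + b)) (sym (double-count′ (suc (suc r)) S)) (sym (double-count′ (suc r) S)) ⟩
      suc r * (∑ V (λ v → new S v * e₂ v) + ∑ V (λ v → new S v * e₁ v))
        ≡⟨ trans (cong (suc r *_) (sym (∑-+ V _ _))) (sym (∑-*ˡ V (suc r) _)) ⟩
      ∑ V (λ v → suc r * (new S v * e₂ v + new S v * e₁ v))
        ≤⟨ ∑-mono V link ⟩
      ∑ V (λ v → suc N * (new S v * e₁ v))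
        ≡⟨ trans (∑-*ˡ V (suc N) _) (cong (suc N *_) (double-count′ (suc r) S)) ⟩
      suc N * (suc r * d₁)
        ≡⟨ x*[y*z]≡y*[x*z] (suc N) (suc r) d₁ ⟩
      suc r * (suc N * d₁) ∎)
      where
      open ≤-Reasoning
      d₂ = d (∣ S ∣ + suc (suc r)) S
      d₁ = d (∣ S ∣ + suc r) S
      e₂ = λ v → d (∣ S ∣ + suc (suc r)) (S ∪ ⁅ v ⁆)
      e₁ = λ v → d (∣ S ∣ + suc r) (S ∪ ⁅ v ⁆)
      x*[y*z]≡y*[x*z] : ∀ x y z → x * (y * z) ≡ y * (x * z)
      x*[y*z]≡y*[x*z] = solve-∀
      peel : ∀ r a b → suc r * (a + b) ≡ (suc r * a + r * b) + b
      peel = solve-∀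
      link-small : ∀ v → v ∉ S → e₁ v < N C r → suc r * (e₂ v + e₁ v) ≤ suc N * e₁ v
      link-small v v∉S lt = begin
        suc r * (e₂ v + e₁ v)                    ≡⟨ peel r (e₂ v) (e₁ v) ⟩
        (suc r * e₂ v + r * e₁ v) + e₁ v         ≤⟨ +-monoˡ-≤ (e₁ v) ih ⟩
        N * e₁ v + e₁ v                          ≡⟨ +-comm (N * e₁ v) (e₁ v) ⟩
        suc N * e₁ v                             ∎
        where
        shift : ∀ j → ∣ S ∪ ⁅ v ⁆ ∣ + j ≡ ∣ S ∣ + suc j
        shift j = trans (cong (_+ j) (∣p∪⁅x⁆∣≡1+∣p∣ v∉S)) (sym (+-suc ∣ S ∣ j))
        ih : suc r * e₂ v + r * e₁ v ≤ N * e₁ v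
        ih with kruskal-katona-step r N (S ∪ ⁅ v ⁆)
        ... | kk rewrite shift r | shift (suc r) = kk lt
      -- This link has at least C(N, r) sets already, so the bound `e₂ v + e₁ v ≤ d₁` from deletion
      -- is enough, because (r+1) C(N+1, r+1) = (N+1) C(N, r).
      link-large : ∀ v → v ∉ S → N C r ≤ e₁ v → suc r * (e₂ v + e₁ v) ≤ suc N * e₁ v
      link-large v v∉S ge = begin
        suc r * (e₂ v + e₁ v)
          ≤⟨ *-monoʳ-≤ (suc r) (subst (λ s → d s (S ∪ ⁅ v ⁆) + e₁ v ≤ d₁) (sym (+-suc ∣ S ∣ (suc r))) (d-delete (∣ S ∣ + suc r) S v v∉S)) ⟩
        suc r * d₁                  ≤⟨ *-monoʳ-≤ (suc r) (<⇒≤ small) ⟩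
        suc r * (suc N C suc r)     ≡⟨ nC-absorb N r ⟩
        suc N * (N C r)             ≤⟨ *-monoʳ-≤ (suc N) ge ⟩
        suc N * e₁ v                ∎
      link : ∀ v → suc r * (new S v * e₂ v + new S v * e₁ v) ≤ suc N * (new S v * e₁ v)
      link v with v ∈? S
      ... | yes _ = ≤-trans (≤-reflexive (*-zeroʳ (suc r))) z≤n
      ... | no v∉S rewrite +-identityʳ (e₂ v) | +-identityʳ (e₁ v) with e₁ v <? N C r
      ...   | yes lt = link-small v v∉S lt
      ...   | no ¬lt = link-large v v∉S (≮⇒≥ ¬lt)

    -- The one-step factors (N-j)/(j+1) multiply to C(N, b)/C(N, a). The smallness hypothesis
    -- survives each step, since the ratio inequality reached so far keeps the count below C(N, j).
    kruskal-katona : ∀ {a b N} S → a ≤ b → b ≤ N → d (∣ S ∣ + a) S < N C a →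
      d (∣ S ∣ + b) S * (N C a) ≤ (N C b) * d (∣ S ∣ + a) S
    kruskal-katona {a} {b} {N} S a≤b b≤N small = go (≤⇒≤′ a≤b) b≤N
      where
      da = d (∣ S ∣ + a) S
      go : ∀ {b} → a ℕ.≤′ b → b ≤ N → d (∣ S ∣ + b) S * (N C a) ≤ (N C b) * da
      go (ℕ.≤′-reflexive refl)    b≤N = ≤-reflexive (*-comm da (N C a))
      go {suc b} (ℕ.≤′-step a≤′b) b<N = *-cancelˡ-≤ (suc b) (begin
        suc b * (db′ * (N C a))       ≡⟨ sym (*-assoc (suc b) db′ (N C a)) ⟩
        suc b * db′ * (N C a)         ≤⟨ *-monoˡ-≤ (N C a) step ⟩
        (N ∸ b) * db * (N C a)        ≡⟨ *-assoc (N ∸ b) db (N C a) ⟩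
        (N ∸ b) * (db * (N C a))      ≤⟨ *-monoʳ-≤ (N ∸ b) ih ⟩
        (N ∸ b) * ((N C b) * da)      ≡⟨ sym (*-assoc (N ∸ b) (N C b) da) ⟩
        (N ∸ b) * (N C b) * da        ≡⟨ cong (_* da) (sym (nC-step b≤N′)) ⟩
        suc b * (N C suc b) * da      ≡⟨ *-assoc (suc b) (N C suc b) da ⟩
        suc b * ((N C suc b) * da)    ∎)
        where
        open ≤-Reasoning
        b≤N′ = <⇒≤ b<N
        db  = d (∣ S ∣ + b) S
        db′ = d (∣ S ∣ + suc b) S
        ih : db * (N C a) ≤ (N C b) * da
        ih = go a≤′b b≤N′
        db-small : db < N C b
        db-small = *-cancelʳ-< (N C a) db (N C b)
          (≤-<-trans ih (*-monoʳ-< (N C b) {{ℕ.>-nonZero (nC-pos b≤N′)}} small))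
        step : suc b * db′ ≤ (N ∸ b) * db
        step = subst (suc b * db′ ≤_) (sym (*-distribʳ-∸ db N b))
          (m+n≤o⇒m≤o∸n (suc b * db′) (kruskal-katona-step b N S db-small))

  -- Sets given by a predicate, unions, and choosing a part of prescribed weight

  module _ {n : ℕ} {P : Fin n → Set ℓ} (P? : ∀ v → Dec (P v)) where

    collect : Subset n
    collect = tabulate (does ∘ P?)

    ∈-collect⁺ : ∀ {v} → P v → v ∈ collect
    ∈-collect⁺ {v} Pv = lookup⇒[]= v _ (trans (lookup∘tabulate _ v) (dec-true (P? v) Pv))

    ∈-collect⁻ : ∀ {v} → v ∈ collect → P v
    ∈-collect⁻ {v} v∈ with P? v | trans (sym (lookup∘tabulate (does ∘ P?) v)) ([]=⇒lookup v∈)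
    ... | yes Pv | _ = Pv

  ∣⋃∣≤∑ : ∀ {n} (L : List (Subset n)) → ∣ ⋃ L ∣ ≤ ∑ L ∣_∣
  ∣⋃∣≤∑ {n} []      = ≤-reflexive (∣⊥∣≡0 n)
  ∣⋃∣≤∑     (S ∷ L) = ≤-trans (∣p∪q∣≤∣p∣+∣q∣ S (⋃ L)) (+-monoʳ-≤ ∣ S ∣ (∣⋃∣≤∑ L))

  ⊆-⋃ : ∀ {n} {S : Subset n} {L} → S ∈ˡ L → S ⊆ ⋃ L
  ⊆-⋃ {L = S ∷ L} (here refl) = p⊆p∪q (⋃ L)
  ⊆-⋃ {L = S ∷ L} (there S∈) = q⊆p∪q S (⋃ L) ∘ ⊆-⋃ S∈

  ∑-filter-≤ : ∀ {P : A → Set ℓ′} (P? : ∀ x → Dec (P x)) (xs : List A) f → ∑ (filter P? xs) f ≤ ∑ xs f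
  ∑-filter-≤ P? []       f = z≤n
  ∑-filter-≤ P? (x ∷ xs) f with P? x
  ... | yes _ = +-monoʳ-≤ (f x) (∑-filter-≤ P? xs f)
  ... | no _  = ≤-trans (∑-filter-≤ P? xs f) (m≤n+m _ (f x))

  -- Elements are dropped from the front while the rest still weighs more than m/2. When the next
  -- drop would fail, head and tail weigh at most m/2 each, hence at most m together.
  suffix-of-weight : ∀ (w : A → ℕ) m L → All (λ x → 2 * w x ≤ m) L → m < 2 * ∑ L w →
    ∃ λ L₁ → ∃ λ L₂ → L ≡ L₁ ++ L₂ × m < 2 * ∑ L₂ w × ∑ L₂ w ≤ m
  suffix-of-weight w m (x ∷ L) (wx ∷ wL) heavy with m <? 2 * ∑ L w
  ... | yes lt = let L₁ , L₂ , eq , rest = suffix-of-weight w m L wL lt in x ∷ L₁ , L₂ , cong (x ∷_) eq , rest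
  ... | no ¬lt = [] , x ∷ L , refl , heavy , *-cancelˡ-≤ 2 (begin
    2 * (w x + ∑ L w)        ≡⟨ *-distribˡ-+ 2 (w x) (∑ L w) ⟩
    2 * w x + 2 * ∑ L w      ≤⟨ +-mono-≤ wx (≮⇒≥ ¬lt) ⟩
    m + m                    ≡⟨ cong (m +_) (sym (+-identityʳ m)) ⟩
    2 * m                    ∎)
    where open ≤-Reasoning

  ^-distribʳ-* : ∀ c a b → (a * b) ^ c ≡ a ^ c * b ^ c
  ^-distribʳ-* zero    a b = refl
  ^-distribʳ-* (suc c) a b = trans (cong (a * b *_) (^-distribʳ-* c a b)) (interchange a b (a ^ c) (b ^ c))
    where
    interchange : ∀ a b p q → a * b * (p * q) ≡ a * p * (b * q)
    interchange = solve-∀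

  4*c≤4^c : ∀ c → 4 * suc c ≤ 4 ^ suc c
  4*c≤4^c zero    = ≤-refl
  4*c≤4^c (suc c) = *-monoʳ-≤ 4 (≤-trans (≤-trans (m≤m+n (suc (suc c)) (2 + 3 * c)) (≤-reflexive (rearrange c))) (4*c≤4^c c))
    where
    rearrange : ∀ c → suc (suc c) + (2 + 3 * c) ≡ 4 * suc c
    rearrange = solve-∀

  -- Fat sets, bad sets, and the descent to light c-sets

  module LightSets
    {n : ℕ} {D : Subset n → Set} (D? : ∀ A → Dec (D A)) (D-down : ∀ {A B} → A ⊆ B → D B → D A)
    (k c′ m N : ℕ)
    (m≤n : m ≤ n) (8k≤m : 8 * k ≤ m) (c<k : suc c′ < k) (k≤N : k ≤ N)
    where

    open Downset D? D-down

    c B : ℕ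
    c = suc c′
    B = N C (k ∸ c)

    deg : Subset n → ℕ
    deg = d k

    inside? : ∀ S X A → Dec ((S ⊆ A × (∣ A ∣ ≡ k × D A)) × A ⊆ X)
    inside? S X A = above? k S A ×-dec (A ⊆? X)

    edgesIn : Subset n → Subset n → ℕ
    edgesIn S X = ∑ Ω (λ A → 𝟙 (inside? S X A))

    edgesIn≤ : ∀ S X → edgesIn S X ≤ edgesIn ∅ X
    edgesIn≤ S X = ∑-mono Ω λ A → 𝟙-mono (inside? S X A) (inside? ∅ X A)
      λ ((_ , rest) , A⊆X) → ((⊥-elim ∘ ∉⊥) , rest) , A⊆X

    -- Per added vertex, the k pays for `∑-new-deg`, where an edge is counted up to k times, and the
    -- 4 leaves at most m/4 fat neighbours. The powers of m stand on the other side in `Fat`, so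
    -- neither a division nor the exponent c - j occurs.
    threshold : ℕ → ℕ
    threshold j = (4 * k) ^ j * (B * n ^ c)

    -- For |S| = j this says that deg S exceeds (4kn/m)^j B n^(c-j), i.e. roughly (k/α)^j B n^(c-j).
    Fat : Subset n → Set
    Fat S = threshold ∣ S ∣ < deg S * m ^ ∣ S ∣

    Fat? : ∀ S → Dec (Fat S)
    Fat? S = threshold ∣ S ∣ <? deg S * m ^ ∣ S ∣

    fatNbr? : ∀ S u → Dec (u ∉ S × Fat (S ∪ ⁅ u ⁆))
    fatNbr? S u = ¬? (u ∈? S) ×-dec Fat? (S ∪ ⁅ u ⁆)

    -- Every vertex outside `X S` is new to S and gives a non-fat extension, so the descent takes
    -- its next vertex there; only edges inside `X S` escape it.
    U X : Subset n → Subset n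
    U S = collect (fatNbr? S)
    X S = S ∪ U S

    instance
      k≢0 : NonZero k
      k≢0 = >-nonZero (<-trans (s≤s z≤n) c<k)
      m≢0 : NonZero m
      m≢0 = >-nonZero (<-≤-trans (*-monoʳ-< 8 (ℕ.>-nonZero⁻¹ k)) 8k≤m)
      n≢0 : NonZero n
      n≢0 = >-nonZero (<-≤-trans (ℕ.>-nonZero⁻¹ m) m≤n)
      B≢0 : NonZero B
      B≢0 = >-nonZero (nC-pos (≤-trans (m∸n≤m k c) k≤N))
      threshold≢0 : ∀ {j} → NonZero (threshold j)
      threshold≢0 {j} = m*n≢0 ((4 * k) ^ j) (B * n ^ c)
        {{m^n≢0 (4 * k) j {{m*n≢0 4 k}}}} {{m*n≢0 B (n ^ c) {{B≢0}} {{m^n≢0 n c}}}}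

    ∑-new-deg : ∀ s S → ∑ V (λ v → new S v * d s (S ∪ ⁅ v ⁆)) ≤ s * d s S
    ∑-new-deg s S = ≤-trans (m≤m+n _ _) (≤-reflexive (double-count s S))

    -- Every vertex of `U S` contributes more than the threshold to the sum of the degrees of the
    -- extensions. `deg S` is not yet estimated: `∣U∣-small` inserts non-fatness, `bad-weight`
    -- inserts badness.
    ∣U∣-weighted : ∀ S → ∣ U S ∣ * threshold (suc ∣ S ∣) ≤ k * deg S * m ^ suc ∣ S ∣
    ∣U∣-weighted S = begin
      ∣ U S ∣ * t                                            ≡⟨ cong (_* t) (∣p∣≡∑ (U S)) ⟩
      ∑ V (λ v → 𝟙 (v ∈? U S)) * t                           ≡⟨ sym (∑-*ʳ V t _) ⟩
      ∑ V (λ v → 𝟙 (v ∈? U S) * t)                           ≤⟨ ∑-mono V fat ⟩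
      ∑ V (λ v → new S v * deg (S ∪ ⁅ v ⁆) * m ^ suc ∣ S ∣)  ≡⟨ ∑-*ʳ V (m ^ suc ∣ S ∣) _ ⟩
      ∑ V (λ v → new S v * deg (S ∪ ⁅ v ⁆)) * m ^ suc ∣ S ∣  ≤⟨ *-monoˡ-≤ (m ^ suc ∣ S ∣) (∑-new-deg k S) ⟩
      k * deg S * m ^ suc ∣ S ∣                              ∎
      where
      open ≤-Reasoning
      t = threshold (suc ∣ S ∣)
      fat : ∀ v → 𝟙 (v ∈? U S) * t ≤ new S v * deg (S ∪ ⁅ v ⁆) * m ^ suc ∣ S ∣
      fat v with v ∈? U S
      ... | no _ = z≤n
      ... | yes v∈U with ∈-collect⁻ (fatNbr? S) v∈U
      ...   | v∉S , fat-v rewrite 𝟙-yes (¬? (v ∈? S)) v∉S | ∣p∪⁅x⁆∣≡1+∣p∣ v∉S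
                          | +-identityʳ t | +-identityʳ (deg (S ∪ ⁅ v ⁆)) = <⇒≤ fat-v

    ∣U∣-small : ∀ S → ¬ Fat S → 4 * ∣ U S ∣ ≤ m
    ∣U∣-small S ¬fat = *-cancelʳ-≤ (4 * ∣ U S ∣) m (k * t) {{m*n≢0 k t {{k≢0}} {{threshold≢0 {∣ S ∣}}}}} (begin
      4 * ∣ U S ∣ * (k * t)                   ≡⟨ regroup₁ ∣ U S ∣ k ((4 * k) ^ ∣ S ∣) (B * n ^ c) ⟩
      ∣ U S ∣ * threshold (suc ∣ S ∣)         ≤⟨ ∣U∣-weighted S ⟩
      k * deg S * (m * m ^ ∣ S ∣)             ≡⟨ regroup₂ k (deg S) m (m ^ ∣ S ∣) ⟩
      m * (k * (deg S * m ^ ∣ S ∣))           ≤⟨ *-monoʳ-≤ m (*-monoʳ-≤ k (≮⇒≥ ¬fat)) ⟩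
      m * (k * t)                             ∎)
      where
      open ≤-Reasoning
      t = threshold ∣ S ∣
      regroup₁ : ∀ u k p b → 4 * u * (k * (p * b)) ≡ u * (4 * k * p * b)
      regroup₁ = solve-∀
      regroup₂ : ∀ k e m p → k * e * (m * p) ≡ m * (k * (e * p))
      regroup₂ = solve-∀

    ∣X∣≤∣S∣+∣U∣ : ∀ S → ∣ X S ∣ ≤ ∣ S ∣ + ∣ U S ∣
    ∣X∣≤∣S∣+∣U∣ S = ∣p∪q∣≤∣p∣+∣q∣ S (U S)

    ∣X∣-small : ∀ S → ∣ S ∣ ≤ c → ¬ Fat S → 2 * ∣ X S ∣ ≤ m
    ∣X∣-small S ∣S∣≤c ¬fat = *-cancelˡ-≤ 2 (begin
      2 * (2 * ∣ X S ∣)                  ≤⟨ *-monoʳ-≤ 2 (*-monoʳ-≤ 2 (∣X∣≤∣S∣+∣U∣ S)) ⟩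
      2 * (2 * (∣ S ∣ + ∣ U S ∣))        ≡⟨ regroup ∣ S ∣ ∣ U S ∣ ⟩
      -- The hypothesis `8 * k ≤ m` makes S itself negligible: 4|S| ≤ 8k ≤ m.
      4 * ∣ S ∣ + 4 * ∣ U S ∣            ≤⟨ +-mono-≤ (*-mono-≤ {4} {8} (m≤m+n 4 4) (≤-trans ∣S∣≤c (<⇒≤ c<k))) (∣U∣-small S ¬fat) ⟩
      8 * k + m                          ≤⟨ +-monoˡ-≤ m 8k≤m ⟩
      m + m                              ≡⟨ cong (m +_) (sym (+-identityʳ m)) ⟩
      2 * m                              ∎)
      where
      open ≤-Reasoning
      regroup : ∀ s u → 2 * (2 * (s + u)) ≡ 4 * s + 4 * u
      regroup = solve-∀

    -- An edge inside `X S` has k vertices, all in S or `U S`. For |S| < k this will produce a fat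
    -- neighbour.
    edgesIn-X-pos : ∀ S → 0 < edgesIn S (X S) → k ≤ ∣ S ∣ + ∣ U S ∣
    edgesIn-X-pos S pos with ∑-pos Ω _ pos
    ... | A , _ , A-pos with 𝟙-pos (inside? S (X S) A) A-pos
    ...   | (_ , ∣A∣≡k , _) , A⊆X = subst (_≤ ∣ S ∣ + ∣ U S ∣) ∣A∣≡k (≤-trans (p⊆q⇒∣p∣≤∣q∣ A⊆X) (∣X∣≤∣S∣+∣U∣ S))

    edgesIn-X-pos⇒U-pos : ∀ S → ∣ S ∣ < k → 0 < edgesIn S (X S) → 0 < ∣ U S ∣
    edgesIn-X-pos⇒U-pos S S<k pos = +-cancelˡ-< ∣ S ∣ 0 (∣ U S ∣)
      (subst (_< ∣ S ∣ + ∣ U S ∣) (sym (+-identityʳ ∣ S ∣)) (<-≤-trans S<k (edgesIn-X-pos S pos)))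

    module _ (sparse : ∀ Y → ∣ Y ∣ ≤ m → edgesIn ∅ Y ≤ B * n) where

      -- A fat neighbour of S makes deg S larger than 2Bn, so the few edges inside X S are negligible.
      not-bad-below : ∀ S → ¬ Fat S → suc ∣ S ∣ < c → 2 * edgesIn S (X S) ≤ deg S
      not-bad-below S ¬fat S<c′ with 0 <? edgesIn S (X S)
      ... | no ¬pos = ≤-trans (*-monoʳ-≤ 2 (≮⇒≥ ¬pos)) z≤n
      ... | yes pos = ≮⇒≥ λ lt → <-irrefl refl (begin-strict
        threshold (suc j)                        <⟨ subst (λ s → threshold s < deg (S ∪ ⁅ u ⁆) * m ^ s) (∣p∪⁅x⁆∣≡1+∣p∣ u∉S) fat-u ⟩
        deg (S ∪ ⁅ u ⁆) * m ^ suc j              ≤⟨ *-monoˡ-≤ (m ^ suc j) (d-mono k {S} {S ∪ ⁅ u ⁆} (p⊆p∪q ⁅ u ⁆)) ⟩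
        deg S * m ^ suc j                        ≤⟨ *-monoˡ-≤ (m ^ suc j) (<⇒≤ lt) ⟩
        -- Here j + 1 ≤ c - 1 enters: m^(j+1) is at most n^(c-1), and the n of the sparsity bound
        -- completes n^c. For j = c - 1 there would be one n too many.
        2 * edgesIn S (X S) * m ^ suc j          ≤⟨ *-mono-≤ (*-monoʳ-≤ 2 few) (≤-trans (^-monoˡ-≤ (suc j) m≤n) (^-monoʳ-≤ n (≤-pred S<c′))) ⟩
        2 * (B * n) * n ^ c′                     ≡⟨ regroup B n (n ^ c′) ⟩
        2 * (B * n ^ c)                          ≤⟨ *-monoˡ-≤ (B * n ^ c) 2≤ ⟩
        threshold (suc j)                        ∎)
        where
        open ≤-Reasoning
        j = ∣ S ∣
        S<k : j < k
        S<k = <-trans (<-trans (n<1+n j) S<c′) c<k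
        U-nonempty : ∃ λ u → u ∈ U S
        U-nonempty = let v , _ , v-pos = ∑-pos V _ (subst (0 <_) (∣p∣≡∑ (U S))
                                         (edgesIn-X-pos⇒U-pos S S<k pos))
                     in v , 𝟙-pos (v ∈? U S) v-pos
        u = proj₁ U-nonempty
        u∉S = proj₁ (∈-collect⁻ (fatNbr? S) (proj₂ U-nonempty))
        fat-u = proj₂ (∈-collect⁻ (fatNbr? S) (proj₂ U-nonempty))
        few : edgesIn S (X S) ≤ B * n
        few = ≤-trans (edgesIn≤ S (X S)) (sparse (X S)
          (≤-trans (m≤m+n _ _) (∣X∣-small S (<⇒≤ (<-trans (n<1+n j) S<c′)) ¬fat)))
        2≤ : 2 ≤ (4 * k) ^ suc j
        2≤ = *-mono-≤ {2} {4 * k} {1} (*-mono-≤ {2} {4} {1} {k} (s≤s (s≤s z≤n)) (ℕ.>-nonZero⁻¹ k)) (m^n>0 (4 * k) {{m*n≢0 4 k}} j)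
        regroup : ∀ b n p → 2 * (b * n) * p ≡ 2 * (b * (n * p))
        regroup = solve-∀

      Bad : Subset n → Set
      Bad S = ∣ S ∣ ≡ c′ × (¬ Fat S × deg S < 2 * edgesIn S (X S))

      bad? : ∀ S → Dec (Bad S)
      bad? S = (∣ S ∣ ≟ c′) ×-dec (¬? (Fat? S) ×-dec (deg S <? 2 * edgesIn S (X S)))

      badSets : List (Subset n)
      badSets = filter bad? Ω

      -- A set with a vertex outside `I` is not bad, and this vertex survives every extension, so
      -- avoiding `I` once at the start settles all later steps.
      I : Subset n
      I = ⋃ badSets

      bad-suffix : ∀ L₁ L₂ → badSets ≡ L₁ ++ L₂ → All Bad L₂
      bad-suffix L₁ L₂ eq = All.++⁻ʳ L₁ (subst (All Bad) eq (All.all-filter bad? Ω))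

      -- Badness puts an edge inside `X S`, so `U S` is nonempty and |S| = c - 1 is absorbed in c |U
      -- S|. Then `deg S` in `∣U∣-weighted` is replaced by twice the number of edges inside `X S`.
      bad-weight : ∀ S → Bad S → ∣ X S ∣ * threshold c ≤ 2 * (c * k * m ^ c) * edgesIn S (X S)
      bad-weight S (refl , ¬fat , bad) = begin
        ∣ X S ∣ * threshold c                      ≤⟨ *-monoˡ-≤ (threshold c) X≤cU ⟩
        c * ∣ U S ∣ * threshold c                  ≡⟨ *-assoc c (∣ U S ∣) (threshold c) ⟩
        c * (∣ U S ∣ * threshold c)                ≤⟨ *-monoʳ-≤ c (∣U∣-weighted S) ⟩
        c * (k * deg S * m ^ c)                    ≤⟨ *-monoʳ-≤ c (*-monoˡ-≤ (m ^ c) (*-monoʳ-≤ k (<⇒≤ bad))) ⟩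
        c * (k * (2 * edgesIn S (X S)) * m ^ c)    ≡⟨ regroup c k (edgesIn S (X S)) (m ^ c) ⟩
        2 * (c * k * m ^ c) * edgesIn S (X S)      ∎
        where
        open ≤-Reasoning
        U-pos : 0 < ∣ U S ∣
        U-pos = edgesIn-X-pos⇒U-pos S (<-trans (n<1+n _) c<k) (*-cancelˡ-< 2 0 _ (≤-<-trans z≤n bad))
        X≤cU : ∣ X S ∣ ≤ c * ∣ U S ∣
        X≤cU = begin
          ∣ X S ∣                          ≤⟨ ∣X∣≤∣S∣+∣U∣ S ⟩
          c′ + ∣ U S ∣                     ≡⟨ cong (_+ ∣ U S ∣) (sym (*-identityʳ c′)) ⟩
          c′ * 1 + ∣ U S ∣                 ≤⟨ +-monoˡ-≤ (∣ U S ∣) (*-monoʳ-≤ c′ U-pos) ⟩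
          c′ * ∣ U S ∣ + ∣ U S ∣           ≡⟨ +-comm (c′ * ∣ U S ∣) (∣ U S ∣) ⟩
          c * ∣ U S ∣                      ∎
        regroup : ∀ c k e p → c * (k * (2 * e) * p) ≡ 2 * (c * k * p) * e
        regroup = solve-∀

      -- An edge contains at most k^c′ sets of size c′.
      overcount : ∀ L₁ L₂ → badSets ≡ L₁ ++ L₂ →
        ∑ L₂ (λ S → edgesIn S (X S)) ≤ k ^ c′ * edgesIn ∅ (⋃ (map X L₂))
      overcount L₁ L₂ eq = begin
        ∑ L₂ (λ S → edgesIn S (X S))
          ≤⟨ ∑-mono-All (All.tabulate {xs = L₂} (λ {S} S∈ → ∑-mono Ω (split S∈))) ⟩
        ∑ L₂ (λ S → ∑ Ω (λ A → sub S A * 𝟙 (inside? ∅ Z A)))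
          ≡⟨ ∑-swap L₂ Ω _ ⟩
        ∑ Ω (λ A → ∑ L₂ (λ S → sub S A * 𝟙 (inside? ∅ Z A)))
          ≡⟨ ∑-cong Ω (λ A → ∑-*ʳ L₂ (𝟙 (inside? ∅ Z A)) (λ S → sub S A)) ⟩
        ∑ Ω (λ A → ∑ L₂ (λ S → sub S A) * 𝟙 (inside? ∅ Z A))
          ≤⟨ ∑-mono Ω (λ A → bound A (inside? ∅ Z A)) ⟩
        ∑ Ω (λ A → k ^ c′ * 𝟙 (inside? ∅ Z A))
          ≡⟨ ∑-*ˡ Ω (k ^ c′) _ ⟩
        k ^ c′ * edgesIn ∅ Z ∎
        where
        open ≤-Reasoning
        Z = ⋃ (map X L₂)
        sub : Subset n → Subset n → ℕ
        sub S A = 𝟙 ((∣ S ∣ ≟ c′) ×-dec (S ⊆? A))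
        split : ∀ {S} → S ∈ˡ L₂ → ∀ A → 𝟙 (inside? S (X S) A) ≤ sub S A * 𝟙 (inside? ∅ Z A)
        split {S} S∈ A = ≤-trans
          (𝟙-mono (inside? S (X S) A) (((∣ S ∣ ≟ c′) ×-dec (S ⊆? A)) ×-dec inside? ∅ Z A)
            λ ((S⊆A , rest) , A⊆X) → (proj₁ (All.lookup (bad-suffix L₁ L₂ eq) S∈) , S⊆A) ,
              (((⊥-elim ∘ ∉⊥) , rest) , (⊆-⋃ (∈-map⁺ X S∈) ∘ A⊆X)))
          (≤-reflexive (𝟙-× ((∣ S ∣ ≟ c′) ×-dec (S ⊆? A)) (inside? ∅ Z A)))
        -- `L₂` is a suffix of a filter of `Ω`, so no set occurs in it more often than in the sum
        -- over all subsets.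
        sub-L₂ : ∀ A → ∑ L₂ (λ S → sub S A) ≤ subsetsOfSize c′ A
        sub-L₂ A = begin
          ∑ L₂ (λ S → sub S A)                            ≤⟨ m≤n+m _ _ ⟩
          ∑ L₁ (λ S → sub S A) + ∑ L₂ (λ S → sub S A)     ≡⟨ sym (∑-++ L₁ L₂ _) ⟩
          ∑ (L₁ ++ L₂) (λ S → sub S A)                    ≡⟨ cong (λ L → ∑ L (λ S → sub S A)) (sym eq) ⟩
          ∑ badSets (λ S → sub S A)                       ≤⟨ ∑-filter-≤ bad? Ω _ ⟩
          subsetsOfSize c′ A                              ∎
        bound : ∀ A (A? : Dec ((∅ ⊆ A × (∣ A ∣ ≡ k × D A)) × A ⊆ Z)) →
                ∑ L₂ (λ S → sub S A) * 𝟙 A? ≤ k ^ c′ * 𝟙 A?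
        bound A (no _) = ≤-trans (≤-reflexive (*-zeroʳ (∑ L₂ (λ S → sub S A)))) z≤n
        bound A (yes ((_ , ∣A∣≡k , _) , _)) = *-monoˡ-≤ 1
          (≤-trans (sub-L₂ A) (subst (λ a → subsetsOfSize c′ A ≤ a ^ c′) ∣A∣≡k (subsetsOfSize≤∣p∣^j c′ A)))

      -- Otherwise some of the sets X S, S bad, have a union of at most m vertices spanning more than Bn edges.
      ∣I∣-small : 2 * ∣ I ∣ ≤ m
      ∣I∣-small = ≮⇒≥ λ lt → contra (suffix-of-weight (∣_∣ ∘ X) m badSets
          (All.map (λ {S} (∣S∣≡ , ¬fat , _) → ∣X∣-small S (≤-trans (≤-reflexive ∣S∣≡) (n≤1+n c′)) ¬fat) (All.all-filter bad? Ω))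
          (<-≤-trans lt (*-monoʳ-≤ 2 (≤-trans (∣⋃∣≤∑ badSets) (∑-mono badSets (λ S → ∣p∣≤∣p∪q∣ S (U S)))))))
        where
        open ≤-Reasoning
        contra : ¬ ∃ λ L₁ → ∃ λ L₂ → badSets ≡ L₁ ++ L₂ × m < 2 * ∑ L₂ (∣_∣ ∘ X) × ∑ L₂ (∣_∣ ∘ X) ≤ m
        contra (L₁ , L₂ , eq , heavy , light) = <-irrefl refl (begin-strict
          m * K
            <⟨ *-monoˡ-< K {{threshold≢0 {c}}} heavy ⟩
          2 * ∑ L₂ (∣_∣ ∘ X) * K
            ≡⟨ trans (*-assoc 2 (∑ L₂ (∣_∣ ∘ X)) K) (cong (2 *_) (sym (∑-*ʳ L₂ K _))) ⟩
          2 * ∑ L₂ (λ S → ∣ X S ∣ * K)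
            ≤⟨ *-monoʳ-≤ 2 (∑-mono-All (All.map (λ {S} → bad-weight S) (bad-suffix L₁ L₂ eq))) ⟩
          2 * ∑ L₂ (λ S → 2 * (c * k * m ^ c) * edgesIn S (X S))
            ≡⟨ cong (2 *_) (∑-*ˡ L₂ (2 * (c * k * m ^ c)) _) ⟩
          2 * (2 * (c * k * m ^ c) * ∑ L₂ (λ S → edgesIn S (X S)))
            ≤⟨ *-monoʳ-≤ 2 (*-monoʳ-≤ (2 * (c * k * m ^ c)) (overcount L₁ L₂ eq)) ⟩
          2 * (2 * (c * k * m ^ c) * (k ^ c′ * edgesIn ∅ (⋃ (map X L₂))))
            ≤⟨ *-monoʳ-≤ 2 (*-monoʳ-≤ (2 * (c * k * m ^ c)) (*-monoʳ-≤ (k ^ c′) (sparse _ small))) ⟩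
          2 * (2 * (c * k * (m * m ^ c′)) * (k ^ c′ * (B * n)))
            ≡⟨ regroup₁ c k m (m ^ c′) (k ^ c′) B n ⟩
          4 * c * (m * (k * k ^ c′) * (B * n)) * m ^ c′
            -- The 4c collects 2 from `heavy` and 2c from `bad-weight`; the power 4^c in the
            -- threshold absorbs it.
            ≤⟨ *-mono-≤ (*-monoˡ-≤ (m * (k * k ^ c′) * (B * n)) (4*c≤4^c c′)) (^-monoˡ-≤ c′ m≤n) ⟩
          4 ^ c * (m * k ^ c * (B * n)) * n ^ c′
            ≡⟨ regroup₂ (4 ^ c) m (k ^ c) B n (n ^ c′) ⟩
          m * (4 ^ c * k ^ c * (B * (n * n ^ c′)))
            ≡⟨ cong (λ p → m * (p * (B * n ^ c))) (sym (^-distribʳ-* c 4 k)) ⟩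
          m * K ∎)
          where
          K = threshold c
          small : ∣ ⋃ (map X L₂) ∣ ≤ m
          small = ≤-trans (∣⋃∣≤∑ (map X L₂)) (≤-trans (≤-reflexive (∑-map X L₂ ∣_∣)) light)
          regroup₁ : ∀ c k m p q b n → 2 * (2 * (c * k * (m * p)) * (q * (b * n))) ≡ 4 * c * (m * (k * q) * (b * n)) * p
          regroup₁ = solve-∀
          regroup₂ : ∀ f m p b n q → f * (m * p * (b * n)) * q ≡ m * (f * p * (b * (n * q)))
          regroup₂ = solve-∀

    -- An edge through S that is not inside Y contains some v outside Y and is counted in
    -- `deg (S ∪ ⁅ v ⁆)`.
    cover : ∀ S Y → deg S ≤ edgesIn S Y + ∑ V (λ v → new Y v * deg (S ∪ ⁅ v ⁆))
    cover S Y = begin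
      deg S
        ≤⟨ ∑-mono Ω pointwise ⟩
      ∑ Ω (λ A → 𝟙 (inside? S Y A) + ∑ V (λ v → new Y v * 𝟙 (above? k (S ∪ ⁅ v ⁆) A)))
        ≡⟨ ∑-+ Ω _ _ ⟩
      edgesIn S Y + ∑ Ω (λ A → ∑ V (λ v → new Y v * 𝟙 (above? k (S ∪ ⁅ v ⁆) A)))
        ≡⟨ cong (edgesIn S Y +_) (∑-swap Ω V _) ⟩
      edgesIn S Y + ∑ V (λ v → ∑ Ω (λ A → new Y v * 𝟙 (above? k (S ∪ ⁅ v ⁆) A)))
        ≡⟨ cong (edgesIn S Y +_) (∑-cong V (λ v → ∑-*ˡ Ω (new Y v) _)) ⟩
      edgesIn S Y + ∑ V (λ v → new Y v * deg (S ∪ ⁅ v ⁆)) ∎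
      where
      open ≤-Reasoning
      pointwise : ∀ A → 𝟙 (above? k S A) ≤ 𝟙 (inside? S Y A) + ∑ V (λ v → new Y v * 𝟙 (above? k (S ∪ ⁅ v ⁆) A))
      pointwise A with any? (λ v → (v ∈? A) ×-dec ¬? (v ∈? Y))
      ... | no none = ≤-trans (𝟙-mono (above? k S A) (inside? S Y A) λ p → p , A⊆Y) (m≤m+n _ _)
        where
        A⊆Y : A ⊆ Y
        A⊆Y {x} x∈A with x ∈? Y
        ... | yes x∈Y = x∈Y
        ... | no  x∉Y = ⊥-elim (none (x , x∈A , x∉Y))
      ... | yes (v , v∈A , v∉Y) = begin
        𝟙 (above? k S A)
          ≤⟨ 𝟙-mono (above? k S A) (¬? (v ∈? Y) ×-dec above? k (S ∪ ⁅ v ⁆) A) (λ (S⊆A , rest) → v∉Y , p∪⁅x⁆⊆q⁺ S⊆A v∈A , rest) ⟩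
        𝟙 (¬? (v ∈? Y) ×-dec above? k (S ∪ ⁅ v ⁆) A)
          ≡⟨ 𝟙-× (¬? (v ∈? Y)) (above? k (S ∪ ⁅ v ⁆) A) ⟩
        new Y v * 𝟙 (above? k (S ∪ ⁅ v ⁆) A)
          ≤⟨ ∑-member (λ v → new Y v * 𝟙 (above? k (S ∪ ⁅ v ⁆) A)) (∈-allFin v) ⟩
        ∑ V (λ v → new Y v * 𝟙 (above? k (S ∪ ⁅ v ⁆) A))
          ≤⟨ m≤n+m _ _ ⟩
        𝟙 (inside? S Y A) + ∑ V (λ v → new Y v * 𝟙 (above? k (S ∪ ⁅ v ⁆) A)) ∎

    module _ (i G : ℕ) where

      -- At least half of the edges through S leave Y and are found in extensions by vertices
      -- outside Y. When the bounds for these extensions are summed, an i-set above S is counted at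
      -- most i times; hence a factor 2i per level.
      descend : ∀ S Y E → S ⊆ Y → 2 * edgesIn S Y ≤ deg S →
        (∀ v → v ∉ Y → deg (S ∪ ⁅ v ⁆) * G ≤ E * d i (S ∪ ⁅ v ⁆)) → deg S * G ≤ 2 * i * E * d i S
      descend S Y E S⊆Y few ext = begin
        deg S * G
          ≤⟨ *-monoˡ-≤ G half ⟩
        2 * ∑ V (λ v → new Y v * deg (S ∪ ⁅ v ⁆)) * G
          ≡⟨ trans (*-assoc 2 (∑ V _) G) (cong (2 *_) (sym (∑-*ʳ V G _))) ⟩
        2 * ∑ V (λ v → new Y v * deg (S ∪ ⁅ v ⁆) * G)
          ≤⟨ *-monoʳ-≤ 2 (∑-mono V pointwise) ⟩
        2 * ∑ V (λ v → E * (new S v * d i (S ∪ ⁅ v ⁆)))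
          ≡⟨ cong (2 *_) (∑-*ˡ V E _) ⟩
        2 * (E * ∑ V (λ v → new S v * d i (S ∪ ⁅ v ⁆)))
          ≤⟨ *-monoʳ-≤ 2 (*-monoʳ-≤ E (∑-new-deg i S)) ⟩
        2 * (E * (i * d i S))
          ≡⟨ regroup E i (d i S) ⟩
        2 * i * E * d i S ∎
        where
        open ≤-Reasoning
        regroup : ∀ e i d → 2 * (e * (i * d)) ≡ 2 * i * e * d
        regroup = solve-∀
        half : deg S ≤ 2 * ∑ V (λ v → new Y v * deg (S ∪ ⁅ v ⁆))
        half = +-cancelˡ-≤ (deg S) _ _ (begin
          deg S + deg S                  ≡⟨ cong (deg S +_) (sym (+-identityʳ (deg S))) ⟩
          2 * deg S                      ≤⟨ *-monoʳ-≤ 2 (cover S Y) ⟩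
          2 * (edgesIn S Y + R)          ≡⟨ *-distribˡ-+ 2 (edgesIn S Y) R ⟩
          2 * edgesIn S Y + 2 * R        ≤⟨ +-monoˡ-≤ (2 * R) few ⟩
          deg S + 2 * R                  ∎)
          where R = ∑ V (λ v → new Y v * deg (S ∪ ⁅ v ⁆))
        pointwise : ∀ v → new Y v * deg (S ∪ ⁅ v ⁆) * G ≤ E * (new S v * d i (S ∪ ⁅ v ⁆))
        pointwise v with v ∈? Y
        ... | yes _ = z≤n
        ... | no v∉Y rewrite 𝟙-yes (¬? (v ∈? S)) (v∉Y ∘ S⊆Y) | +-identityʳ (deg (S ∪ ⁅ v ⁆)) | +-identityʳ (d i (S ∪ ⁅ v ⁆)) = ext v v∉Y

    ¬Fat-outside : ∀ S {v} → v ∉ X S → ¬ Fat (S ∪ ⁅ v ⁆)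
    ¬Fat-outside S {v} v∉X fat = v∉X (q⊆p∪q S (U S) (∈-collect⁺ (fatNbr? S) ((v∉X ∘ p⊆p∪q (U S)) , fat)))

    module _ (i : ℕ) (c≤i : c ≤ i) (i≤k : i ≤ k)
             (sparse : ∀ Y → ∣ Y ∣ ≤ m → edgesIn ∅ Y ≤ B * n)
             (half : ∀ Y → ∣ Y ∣ ≤ m → 2 * edgesIn ∅ Y ≤ deg ∅)
             (few-edges : deg ∅ ≤ n ^ c) where

      -- `deg S * G ≤ H * d i S` is the fraction-free form of: the i-shadow above S is at least deg
      -- S times C(N, i-c)/C(N, k-c) times (m/(4kn))^c.
      G H : ℕ
      G = (N C (i ∸ c)) * m ^ c
      H = (4 * k * n) ^ c * B

      -- If `d i S` is below C(N, i-c), Kruskal-Katona in the link gives the ratio, and m ≤ 4kn fits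
      -- it to the constant. Otherwise `d i S` is at least C(N, i-c), while non-fatness gives
      -- `deg S * m ^ c ≤ H`.
      light-set-shadow : ∀ S → ∣ S ∣ ≡ c → ¬ Fat S → deg S * G ≤ H * d i S
      light-set-shadow S ∣S∣≡c ¬fat with d i S <? N C (i ∸ c)
      ... | yes small = begin
        deg S * ((N C (i ∸ c)) * m ^ c)    ≡⟨ sym (*-assoc (deg S) _ _) ⟩
        deg S * (N C (i ∸ c)) * m ^ c      ≤⟨ *-mono-≤ kk (^-monoˡ-≤ c m≤4kn) ⟩
        B * d i S * (4 * k * n) ^ c        ≡⟨ regroup B (d i S) ((4 * k * n) ^ c) ⟩
        H * d i S                          ∎
        where
        open ≤-Reasoning
        regroup : ∀ b d p → b * d * p ≡ p * b * d
        regroup = solve-∀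
        m≤4kn : m ≤ 4 * k * n
        m≤4kn = ≤-trans m≤n (m≤n*m n (4 * k) {{m*n≢0 4 k}})
        size : ∀ {s} → c ≤ s → ∣ S ∣ + (s ∸ c) ≡ s
        size c≤s = trans (cong (_+ _) ∣S∣≡c) (m+[n∸m]≡n c≤s)
        kk : deg S * (N C (i ∸ c)) ≤ B * d i S
        kk with kruskal-katona {i ∸ c} {k ∸ c} {N} S (∸-monoˡ-≤ c i≤k) (≤-trans (m∸n≤m k c) k≤N)
        ... | f rewrite size c≤i | size (<⇒≤ c<k) = f small
      ... | no ¬small = begin
        deg S * ((N C (i ∸ c)) * m ^ c)       ≡⟨ regroup (deg S) (N C (i ∸ c)) (m ^ c) ⟩
        deg S * m ^ c * (N C (i ∸ c))         ≤⟨ *-mono-≤ (subst (λ s → deg S * m ^ s ≤ threshold s) ∣S∣≡c (≮⇒≥ ¬fat)) (≮⇒≥ ¬small) ⟩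
        (4 * k) ^ c * (B * n ^ c) * d i S     ≡⟨ cong (_* d i S) (regroup′ ((4 * k) ^ c) B (n ^ c)) ⟩
        (4 * k) ^ c * n ^ c * B * d i S       ≡⟨ cong (λ p → p * B * d i S) (sym (^-distribʳ-* c (4 * k) n)) ⟩
        H * d i S                             ∎
        where
        open ≤-Reasoning
        regroup : ∀ e b p → e * (b * p) ≡ e * p * b
        regroup = solve-∀
        regroup′ : ∀ a b c → a * (b * c) ≡ a * c * b
        regroup′ = solve-∀

      -- Induction on the number t of vertices missing to size c. The vertex outside `I` is carried
      -- along to exclude badness when |S| = c - 1; below that size `not-bad-below` applies.
      good-set-shadow : ∀ t S → ∣ S ∣ + t ≡ c → ¬ Fat S → (∃ λ v → v ∈ S × v ∉ I sparse) →
                        deg S * G ≤ (2 * i) ^ t * H * d i S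
      good-set-shadow zero S eq ¬fat _ =
        subst (λ h → deg S * G ≤ h * d i S) (sym (*-identityˡ H)) (light-set-shadow S (trans (sym (+-identityʳ _)) eq) ¬fat)
      good-set-shadow (suc t) S eq ¬fat (w , w∈S , w∉I) =
        subst (λ e → deg S * G ≤ e * d i S) (sym (*-assoc (2 * i) ((2 * i) ^ t) H))
          (descend i G S (X S) ((2 * i) ^ t * H) (p⊆p∪q (U S)) not-bad λ v v∉X →
            good-set-shadow t (S ∪ ⁅ v ⁆)
              (trans (cong (_+ t) (∣p∪⁅x⁆∣≡1+∣p∣ (v∉X ∘ p⊆p∪q (U S)))) (trans (sym (+-suc ∣ S ∣ t)) eq))
              (¬Fat-outside S v∉X) (w , p⊆p∪q ⁅ v ⁆ w∈S , w∉I))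
        where
        eq′ : ∣ S ∣ + t ≡ c′
        eq′ = suc-injective (trans (sym (+-suc ∣ S ∣ t)) eq)
        not-bad : 2 * edgesIn S (X S) ≤ deg S
        not-bad with ∣ S ∣ ≟ c′
        ... | yes ∣S∣≡c′ = ≮⇒≥ λ bad → w∉I (⊆-⋃ (∈-filter⁺ (bad? sparse) (∈-allSubsets S) (∣S∣≡c′ , ¬fat , bad)) w∈S)
        ... | no  ∣S∣≢c′ = not-bad-below sparse S ¬fat
          (s≤s (≤∧≢⇒< (≤-trans (m≤m+n ∣ S ∣ t) (≤-reflexive eq′)) ∣S∣≢c′))

      shadow-bound : deg ∅ * G ≤ (2 * i) ^ c * H * d i ∅
      shadow-bound = subst (λ e → deg ∅ * G ≤ e * d i ∅) (sym (*-assoc (2 * i) ((2 * i) ^ c′) H))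
        (descend i G ∅ Y ((2 * i) ^ c′ * H) (⊥-elim ∘ ∉⊥) (half Y Y-small) λ v v∉Y →
          good-set-shadow c′ (∅ ∪ ⁅ v ⁆)
            (cong (_+ c′) (trans (∣p∪⁅x⁆∣≡1+∣p∣ {v = v} {S = ∅} ∉⊥) (cong suc (∣⊥∣≡0 n))))
            (¬Fat-outside ∅ (v∉Y ∘ p⊆p∪q (I sparse)))
            (v , q⊆p∪q ∅ ⁅ v ⁆ (x∈⁅x⁆ v) , v∉Y ∘ q⊆p∪q (X ∅) (I sparse)))
        where
        open ≤-Reasoning
        -- Avoiding `X ∅` excludes fat singletons, and avoiding `I` provides the vertex to carry
        -- along. Each part has at most m/2 vertices, so `half` applies to Y.
        Y = X ∅ ∪ I sparse
        ¬fat-∅ : ¬ Fat ∅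
        ¬fat-∅ fat = <⇒≱ fat (begin
          deg ∅ * m ^ ∣ ∅ {n} ∣                  ≡⟨ cong (λ s → deg ∅ * m ^ s) (∣⊥∣≡0 n) ⟩
          deg ∅ * 1                              ≡⟨ *-identityʳ (deg ∅) ⟩
          deg ∅                                  ≤⟨ few-edges ⟩
          n ^ c                                  ≤⟨ m≤n*m (n ^ c) B ⟩
          B * n ^ c                              ≡⟨ sym (*-identityˡ _) ⟩
          threshold 0                            ≡⟨ cong threshold (sym (∣⊥∣≡0 n)) ⟩
          threshold ∣ ∅ {n} ∣                    ∎)
        Y-small : ∣ Y ∣ ≤ m
        Y-small = *-cancelˡ-≤ 2 (begin
          2 * ∣ Y ∣                          ≤⟨ *-monoʳ-≤ 2 (∣p∪q∣≤∣p∣+∣q∣ (X ∅) (I sparse)) ⟩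
          2 * (∣ X ∅ ∣ + ∣ I sparse ∣)       ≡⟨ *-distribˡ-+ 2 (∣ X ∅ ∣) (∣ I sparse ∣) ⟩
          2 * ∣ X ∅ ∣ + 2 * ∣ I sparse ∣     ≤⟨ +-mono-≤ (∣X∣-small ∅ (≤-trans (≤-reflexive (∣⊥∣≡0 n)) z≤n) ¬fat-∅) (∣I∣-small sparse) ⟩
          m + m                              ≡⟨ cong (m +_) (sym (+-identityʳ m)) ⟩
          2 * m                              ∎)

  -- From lists of edges to sums over all subsets

  infix 4 _≟ˢ_
  _≟ˢ_ : (A B : Subset n) → Dec (A ≡ B)
  _≟ˢ_ = ≡-dec Bool._≟_

  ∑-point : ∀ (e : Subset n) (g : Subset n → ℕ) → ∑ (allSubsets n) (λ A → 𝟙 (A ≟ˢ e) * g A) ≡ g e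
  ∑-point [] g = trans (+-identityʳ _) (*-identityˡ (g []))
  ∑-point {suc n} (outside ∷ e) g = begin
    ∑ (allSubsets (suc n)) (λ A → 𝟙 (A ≟ˢ outside ∷ e) * g A)
      ≡⟨ ∑-allSubsets-suc (λ A → 𝟙 (A ≟ˢ outside ∷ e) * g A) ⟩
    ∑ Ω (λ A → 𝟙 (outside ∷ A ≟ˢ outside ∷ e) * g (outside ∷ A)) + ∑ Ω (λ A → 𝟙 (inside ∷ A ≟ˢ outside ∷ e) * g (inside ∷ A))
      ≡⟨ cong₂ _+_
           (∑-cong Ω (λ A → cong (_* g (outside ∷ A)) (𝟙-cong (outside ∷ A ≟ˢ outside ∷ e) (A ≟ˢ e) ∷-injectiveʳ (cong (outside ∷_)))))
           (∑-cong Ω (λ A → cong (_* g (inside ∷ A)) (𝟙-no (inside ∷ A ≟ˢ outside ∷ e) λ ()))) ⟩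
    ∑ Ω (λ A → 𝟙 (A ≟ˢ e) * g (outside ∷ A)) + ∑ Ω (λ _ → 0)
      ≡⟨ cong₂ _+_ (∑-point e (g ∘ (outside ∷_))) (∑-zero Ω) ⟩
    g (outside ∷ e) + 0
      ≡⟨ +-identityʳ _ ⟩
    g (outside ∷ e) ∎
    where
    open ≡-Reasoning
    Ω = allSubsets n
  ∑-point {suc n} (inside ∷ e) g = begin
    ∑ (allSubsets (suc n)) (λ A → 𝟙 (A ≟ˢ inside ∷ e) * g A)
      ≡⟨ ∑-allSubsets-suc (λ A → 𝟙 (A ≟ˢ inside ∷ e) * g A) ⟩
    ∑ Ω (λ A → 𝟙 (outside ∷ A ≟ˢ inside ∷ e) * g (outside ∷ A)) + ∑ Ω (λ A → 𝟙 (inside ∷ A ≟ˢ inside ∷ e) * g (inside ∷ A))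
      ≡⟨ cong₂ _+_
           (∑-cong Ω (λ A → cong (_* g (outside ∷ A)) (𝟙-no (outside ∷ A ≟ˢ inside ∷ e) λ ())))
           (∑-cong Ω (λ A → cong (_* g (inside ∷ A)) (𝟙-cong (inside ∷ A ≟ˢ inside ∷ e) (A ≟ˢ e) ∷-injectiveʳ (cong (inside ∷_))))) ⟩
    ∑ Ω (λ _ → 0) + ∑ Ω (λ A → 𝟙 (A ≟ˢ e) * g (inside ∷ A))
      ≡⟨ cong₂ _+_ (∑-zero Ω) (∑-point e (g ∘ (inside ∷_))) ⟩
    g (inside ∷ e) ∎
    where
    open ≡-Reasoning
    Ω = allSubsets n

  -- Distinctness of the edges makes the list behave as a set; sums over all subsets are the form in
  -- which degrees are counted.
  ∑-unique : ∀ {F : List (Subset n)} → Unique F → (g : Subset n → ℕ) →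
             ∑ F g ≡ ∑ (allSubsets n) (λ A → 𝟙 (Any.any? (A ≟ˢ_) F) * g A)
  ∑-unique {n} {[]}    _          g = sym (∑-zero (allSubsets n))
  ∑-unique {n} {e ∷ F} (e∉F ∷ uniq) g = begin
    g e + ∑ F g
      ≡⟨ cong₂ _+_ (sym (∑-point e g)) (∑-unique uniq g) ⟩
    ∑ Ω (λ A → 𝟙 (A ≟ˢ e) * g A) + ∑ Ω (λ A → 𝟙 (Any.any? (A ≟ˢ_) F) * g A)
      ≡⟨ sym (∑-+ Ω _ _) ⟩
    ∑ Ω (λ A → 𝟙 (A ≟ˢ e) * g A + 𝟙 (Any.any? (A ≟ˢ_) F) * g A)
      ≡⟨ ∑-cong Ω (λ A → trans (sym (*-distribʳ-+ (g A) (𝟙 (A ≟ˢ e)) (𝟙 (Any.any? (A ≟ˢ_) F)))) (cong (_* g A) (disjoint A (A ≟ˢ e)))) ⟩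
    ∑ Ω (λ A → 𝟙 (Any.any? (A ≟ˢ_) (e ∷ F)) * g A) ∎
    where
    open ≡-Reasoning
    Ω = allSubsets n
    disjoint : ∀ A (A≟e : Dec (A ≡ e)) → 𝟙 A≟e + 𝟙 (Any.any? (A ≟ˢ_) F) ≡ 𝟙 (Any.any? (A ≟ˢ_) (e ∷ F))
    disjoint A (yes refl) = trans (cong suc (𝟙-no (Any.any? (A ≟ˢ_) F) λ A∈F → All.lookup e∉F A∈F refl))
                                  (sym (𝟙-yes (Any.any? (A ≟ˢ_) (e ∷ F)) (here refl)))
    disjoint A (no A≢e) = 𝟙-cong (Any.any? (A ≟ˢ_) F) (Any.any? (A ≟ˢ_) (e ∷ F)) there λ where
      (here A≡e)  → ⊥-elim (A≢e A≡e)
      (there A∈F) → A∈F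

  p⊆q∧∣p∣≡∣q∣⇒p≡q : ∀ {S T : Subset n} → S ⊆ T → ∣ S ∣ ≡ ∣ T ∣ → S ≡ T
  p⊆q∧∣p∣≡∣q∣⇒p≡q {S = S} {T} S⊆T eq = ⊆-antisym S⊆T T⊆S
    where
    T⊆S : T ⊆ S
    T⊆S {x} x∈T with x ∈? S
    ... | yes x∈S = x∈S
    ... | no  x∉S = ⊥-elim (<-irrefl eq (p⊂q⇒∣p∣<∣q∣ (S⊆T , x , x∈T , x∉S)))

  ∈⇒≤foldr-⊔ : ∀ {a L} → a ∈ˡ L → a ≤ foldr _⊔_ 0 L
  ∈⇒≤foldr-⊔ {L = b ∷ L} (here refl) = m≤m⊔n b (foldr _⊔_ 0 L)
  ∈⇒≤foldr-⊔ {L = b ∷ L} (there a∈) = ≤-trans (∈⇒≤foldr-⊔ a∈) (m≤n⊔m b (foldr _⊔_ 0 L))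

  -- `wp` ranges over sets of exactly m vertices, so a smaller Y is first padded to size m, which
  -- `m ≤ n` permits.
  inducedEdges≤wp : ∀ (F : Hypergraph n) {m} Y → m ≤ n → ∣ Y ∣ ≤ m → inducedEdges F Y ≤ wp F m
  inducedEdges≤wp {n} F {m} Y m≤n Y≤m with interpolate {S = Y} {T = full} m (⊆-max Y) Y≤m (≤-trans m≤n (≤-reflexive (sym (∣⊤∣≡n n))))
  ... | R , Y⊆R , _ , ∣R∣≡m = begin
    inducedEdges F Y                ≡⟨ length-filter (_⊆? Y) F ⟩
    ∑ F (λ e → 𝟙 (e ⊆? Y))          ≤⟨ ∑-mono F (λ e → 𝟙-mono (e ⊆? Y) (e ⊆? R) (λ e⊆Y {x} x∈e → Y⊆R (e⊆Y x∈e))) ⟩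
    ∑ F (λ e → 𝟙 (e ⊆? R))          ≡⟨ sym (length-filter (_⊆? R) F) ⟩
    inducedEdges F R                ≤⟨ ∈⇒≤foldr-⊔ (∈-map⁺ (inducedEdges F) (∈-filter⁺ (λ I → ∣ I ∣ ≟ m) (∈-allSubsets R) ∣R∣≡m)) ⟩
    wp F m                          ∎
    where open ≤-Reasoning

  -- Raising both indices p = a + c and q = b + c by one costs (N-p)(q+1)/((N-q)(p+1)), which is at
  -- most 2k because q + 1 ≤ k and 2q ≤ N. This trades binomials of links for those of the theorem.
  nC-exchange : ∀ {N k} c a b → a ≤ b → b + c ≤ k → 2 * k ≤ N →
    (N C (a + c)) * (N C b) ≤ (2 * k) ^ c * ((N C a) * (N C (b + c)))
  nC-exchange {N} {k} zero a b a≤b b≤k 2k≤N rewrite +-identityʳ a | +-identityʳ b = ≤-reflexive (sym (*-identityˡ _))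
  nC-exchange {N} {k} (suc c) a b a≤b b+c<k 2k≤N rewrite +-suc a c | +-suc b c =
    *-cancelʳ-≤ _ _ Cq {{>-nonZero (nC-pos q≤N)}} (begin
      Cp′ * Cb * Cq                                ≡⟨ regroup₁ Cp′ Cb Cq ⟩
      Cp′ * Cq * Cb                                ≤⟨ *-monoˡ-≤ Cb single ⟩
      2 * k * (Cp * Cq′) * Cb                      ≡⟨ regroup₂ (2 * k) Cp Cq′ Cb ⟩
      2 * k * Cq′ * (Cp * Cb)                      ≤⟨ *-monoʳ-≤ (2 * k * Cq′) (nC-exchange c a b a≤b (<⇒≤ b+c<k) 2k≤N) ⟩
      2 * k * Cq′ * ((2 * k) ^ c * (Ca * Cq))      ≡⟨ regroup₃ (2 * k) Cq′ ((2 * k) ^ c) Ca Cq ⟩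
      2 * k * (2 * k) ^ c * (Ca * Cq′) * Cq        ∎)
    where
    open ≤-Reasoning
    p = a + c
    q = b + c
    p≤q : p ≤ q
    p≤q = +-monoˡ-≤ c a≤b
    2q≤N : 2 * q ≤ N
    2q≤N = ≤-trans (*-monoʳ-≤ 2 (<⇒≤ b+c<k)) 2k≤N
    q≤N : q ≤ N
    q≤N = ≤-trans (m≤m+n q _) 2q≤N
    Ca = N C a
    Cb = N C b
    Cp = N C p
    Cq = N C q
    Cp′ = N C suc p
    Cq′ = N C suc q
    regroup₁ : ∀ a b c → a * b * c ≡ a * c * b
    regroup₁ = solve-∀
    regroup₂ : ∀ k a b c → k * (a * b) * c ≡ k * b * (a * c)
    regroup₂ = solve-∀
    regroup₃ : ∀ k b p a c → k * b * (p * (a * c)) ≡ k * p * (a * b) * c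
    regroup₃ = solve-∀
    N-p≤2[N-q] : N ∸ p ≤ 2 * (N ∸ q)
    N-p≤2[N-q] = begin
      N ∸ p               ≤⟨ m∸n≤m N p ⟩
      N                   ≡⟨ sym (m+n∸n≡m N N) ⟩
      N + N ∸ N           ≤⟨ ∸-monoʳ-≤ (N + N) 2q≤N ⟩
      N + N ∸ 2 * q       ≡⟨ cong (λ M → N + M ∸ 2 * q) (sym (+-identityʳ N)) ⟩
      2 * N ∸ 2 * q       ≡⟨ sym (*-distribˡ-∸ 2 N q) ⟩
      2 * (N ∸ q)         ∎
    single : Cp′ * Cq ≤ 2 * k * (Cp * Cq′)
    single = begin
      Cp′ * Cq                        ≤⟨ *-monoˡ-≤ Cq (m≤n*m Cp′ (suc p)) ⟩
      suc p * Cp′ * Cq                ≡⟨ cong (_* Cq) (nC-step (≤-trans p≤q q≤N)) ⟩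
      (N ∸ p) * Cp * Cq               ≤⟨ *-monoˡ-≤ Cq (*-monoˡ-≤ Cp N-p≤2[N-q]) ⟩
      2 * (N ∸ q) * Cp * Cq           ≡⟨ regroup₄ (N ∸ q) Cp Cq ⟩
      2 * Cp * ((N ∸ q) * Cq)         ≡⟨ cong (2 * Cp *_) (sym (nC-step q≤N)) ⟩
      2 * Cp * (suc q * Cq′)          ≤⟨ *-monoʳ-≤ (2 * Cp) (*-monoˡ-≤ Cq′ b+c<k) ⟩
      2 * Cp * (k * Cq′)              ≡⟨ regroup₅ k Cp Cq′ ⟩
      2 * k * (Cp * Cq′)              ∎
      where
      regroup₄ : ∀ a b c → 2 * a * b * c ≡ 2 * b * (a * c)
      regroup₄ = solve-∀
      regroup₅ : ∀ k a b → 2 * a * (k * b) ≡ 2 * k * (a * b)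
      regroup₅ = solve-∀

  -- With f = n^r, r > c - 1 and r ≥ 1 give 5r = 3r + 2r > 3(c-1) + 2, so the integer ⌈5r⌉ is at
  -- least 3c.
  exponent-bound : ∀ {n f} c′ c₅ → 2 ≤ n → n ≤ f → n ^ c′ < f → f ^ 5 ≤ n ^ c₅ → suc c′ * 3 ≤ c₅
  exponent-bound {n} {f} c′ c₅ 2≤n n≤f n^c′<f f⁵≤ = subst (_≤ c₅) (shape c′) (≰⇒> λ c₅≤ → <⇒≱ n^<f⁵ (begin
      f ^ 5                     ≤⟨ f⁵≤ ⟩
      n ^ c₅                    ≤⟨ ^-monoʳ-≤ n {{>-nonZero (≤-trans (s≤s z≤n) 2≤n)}} c₅≤ ⟩
      n ^ (c′ * 3 + 2)          ∎))
    where
    open ≤-Reasoning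
    shape : ∀ c → suc (c * 3 + 2) ≡ suc c * 3
    shape = solve-∀
    n^<f⁵ : n ^ (c′ * 3 + 2) < f ^ 5
    n^<f⁵ = begin-strict
      n ^ (c′ * 3 + 2)          ≡⟨ ^-distribˡ-+-* n (c′ * 3) 2 ⟩
      n ^ (c′ * 3) * n ^ 2      ≡⟨ cong (_* n ^ 2) (sym (^-*-assoc n c′ 3)) ⟩
      (n ^ c′) ^ 3 * n ^ 2      <⟨ *-monoˡ-< (n ^ 2) {{m^n≢0 n 2 {{>-nonZero (≤-trans (s≤s z≤n) 2≤n)}}}} (^-monoˡ-< 3 n^c′<f) ⟩
      f ^ 3 * n ^ 2             ≤⟨ *-monoʳ-≤ (f ^ 3) (^-monoˡ-≤ 2 n≤f) ⟩
      f ^ 3 * f ^ 2             ≡⟨ sym (^-distribˡ-+-* f 3 2) ⟩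
      f ^ 5                     ∎

  -- The shadow of a uniform hypergraph as a downset

  module _ {n k : ℕ} (F : Hypergraph n) (uniq : Unique F) (uniform : All (λ e → ∣ e ∣ ≡ k) F) where

    Shadow? : ∀ A → Dec (Any (A ⊆_) F)
    Shadow? A = Any.any? (A ⊆?_) F

    Shadow-down : ∀ {A B} → A ⊆ B → Any (B ⊆_) F → Any (A ⊆_) F
    Shadow-down A⊆B = Any.map λ B⊆e {x} x∈A → B⊆e (A⊆B x∈A)

    open Downset Shadow? Shadow-down using (d; d-pos; above?)

    shadowSize≡d : ∀ i → shadowSize F i ≡ d i ∅
    shadowSize≡d i = trans (length-filter (λ S → (∣ S ∣ ≟ i) ×-dec Any.any? (S ⊆?_) F) (allSubsets n))
      (∑-cong (allSubsets n) λ A → 𝟙-cong ((∣ A ∣ ≟ i) ×-dec Shadow? A) (above? i ∅ A) (λ p → (⊥-elim ∘ ∉⊥) , p) proj₂)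

    -- By uniformity a k-set inside an edge is that edge, so the k-sets of the downset are exactly
    -- the edges.
    edge⁻ : ∀ {A} → ∣ A ∣ ≡ k × Any (A ⊆_) F → A ∈ˡ F
    edge⁻ {A} (∣A∣≡k , A∈) = go uniform A∈
      where
      go : ∀ {F} → All (λ e → ∣ e ∣ ≡ k) F → Any (A ⊆_) F → A ∈ˡ F
      go (∣e∣≡k ∷ _) (here A⊆e) = here (p⊆q∧∣p∣≡∣q∣⇒p≡q A⊆e (trans ∣A∣≡k (sym ∣e∣≡k)))
      go (_ ∷ unif) (there A∈)  = there (go unif A∈)

    edge⁺ : ∀ {A} → A ∈ˡ F → ∣ A ∣ ≡ k × Any (A ⊆_) F
    edge⁺ A∈F = All.lookup uniform A∈F , Any.map ⊆-reflexive A∈F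

    length≡d : length F ≡ d k ∅
    length≡d = begin
      length F                                                     ≡⟨ length≡∑1 F ⟩
      ∑ F (λ _ → 1)                                                ≡⟨ ∑-unique uniq _ ⟩
      ∑ (allSubsets n) (λ A → 𝟙 (Any.any? (A ≟ˢ_) F) * 1)              ≡⟨ ∑-cong (allSubsets n) (λ A → trans (*-identityʳ _)
        (𝟙-cong (Any.any? (A ≟ˢ_) F) (above? k ∅ A) (λ A∈F → (⊥-elim ∘ ∉⊥) , edge⁺ A∈F) (λ (_ , p) → edge⁻ p))) ⟩
      d k ∅                                                        ∎
      where
      open ≡-Reasoning
      length≡∑1 : ∀ (L : Hypergraph n) → length L ≡ ∑ L (λ _ → 1)
      length≡∑1 []      = refl
      length≡∑1 (_ ∷ L) = cong suc (length≡∑1 L)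

    shadowSize-pos : ∀ {i} → i ≤ k → 0 < length F → 0 < shadowSize F i
    shadowSize-pos {i} i≤k pos = subst (0 <_) (sym (shadowSize≡d i)) (witness F uniform pos λ e∈F → e∈F)
      where
      witness : ∀ L → All (λ e → ∣ e ∣ ≡ k) L → 0 < length L → (∀ {e} → e ∈ˡ L → e ∈ˡ F) → 0 < d i ∅
      witness (e ∷ _) (∣e∣≡k ∷ _) _ L⊆F =
        let R , _ , R⊆e , ∣R∣≡i = interpolate {S = ∅} {T = e} i (⊥-elim ∘ ∉⊥)
              (≤-trans (≤-reflexive (∣⊥∣≡0 n)) z≤n) (subst (i ≤_) (sym ∣e∣≡k) i≤k)
        in d-pos i ∅ (⊥-elim ∘ ∉⊥) ∣R∣≡i (Shadow-down R⊆e (proj₂ (edge⁺ (L⊆F (here refl)))))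

    module _ (c′ m N i : ℕ) (m≤n : m ≤ n) (8k≤m : 8 * k ≤ m) (2k≤N : 2 * k ≤ N)
      (c<i : suc c′ < i) (i≤k : i ≤ k) (few : length F ≤ n ^ suc c′)
      (sparse : wp F m ≤ (N C (k ∸ suc c′)) * n) (half : 2 * wp F m ≤ length F) where

      private
        c = suc c′
        c<k = <-≤-trans c<i i≤k
        k≤N = ≤-trans (m≤m+n k _) 2k≤N
        f = length F
        s = shadowSize F i
        B = N C (k ∸ c)
        Ca = N C (i ∸ c)
        Ci = N C i
        Ck = N C k
        M = m ^ c

      open LightSets Shadow? Shadow-down k c′ m N m≤n 8k≤m c<k k≤N using (edgesIn; inside?; shadow-bound)

      edgesIn≤wp : ∀ Y → ∣ Y ∣ ≤ m → edgesIn ∅ Y ≤ wp F m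
      edgesIn≤wp Y Y≤m = begin
        edgesIn ∅ Y
          ≤⟨ ∑-mono (allSubsets n) (λ A → ≤-trans
               (𝟙-mono (inside? ∅ Y A) (Any.any? (A ≟ˢ_) F ×-dec (A ⊆? Y)) (λ ((_ , p) , A⊆Y) → edge⁻ p , A⊆Y))
               (≤-reflexive (𝟙-× (Any.any? (A ≟ˢ_) F) (A ⊆? Y)))) ⟩
        ∑ (allSubsets n) (λ A → 𝟙 (Any.any? (A ≟ˢ_) F) * 𝟙 (A ⊆? Y))
          ≡⟨ sym (∑-unique uniq (λ A → 𝟙 (A ⊆? Y))) ⟩
        ∑ F (λ e → 𝟙 (e ⊆? Y))
          ≡⟨ sym (length-filter (_⊆? Y) F) ⟩
        inducedEdges F Y
          ≤⟨ inducedEdges≤wp F Y m≤n Y≤m ⟩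
        wp F m ∎
        where open ≤-Reasoning

      light-shadow : f * (Ca * M) ≤ (2 * i) ^ c * ((4 * k * n) ^ c * B) * s
      light-shadow = subst (λ a → f * (Ca * M) ≤ (2 * i) ^ c * ((4 * k * n) ^ c * B) * a) (sym (shadowSize≡d i))
        (subst (λ a → a * (Ca * M) ≤ (2 * i) ^ c * ((4 * k * n) ^ c * B) * d i ∅) (sym length≡d)
          (shadow-bound i (<⇒≤ c<i) i≤k
            (λ Y Y≤m → ≤-trans (edgesIn≤wp Y Y≤m) sparse)
            (λ Y Y≤m → ≤-trans (*-monoʳ-≤ 2 (edgesIn≤wp Y Y≤m)) (≤-trans half (≤-reflexive length≡d)))
            (≤-trans (≤-reflexive (sym length≡d)) few)))

      exchange : Ci * B ≤ (2 * k) ^ c * (Ca * Ck)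
      exchange with nC-exchange {N} {k} c (i ∸ c) (k ∸ c) (∸-monoˡ-≤ c i≤k) (≤-reflexive (m∸n+n≡m (<⇒≤ c<k))) 2k≤N
      ... | le rewrite m∸n+n≡m (<⇒≤ c<i) | m∸n+n≡m (<⇒≤ c<k) = le

      -- (2k)^c comes from `exchange`, (2i)^c from the descent and (4kn)^c from fatness. The leading
      -- 2 is set aside for rounding x to a natural number.
      constants : 2 * ((2 * k) ^ c * ((2 * i) ^ c * (4 * k * n) ^ c)) ≤ (32 * (k * k * k) * n) ^ c
      constants = begin
        2 * ((2 * k) ^ c * ((2 * i) ^ c * (4 * k * n) ^ c))
          ≤⟨ *-mono-≤ {2} {2 ^ c} (m≤m*n 2 (2 ^ c′) {{m^n≢0 2 c′}})
               (*-monoʳ-≤ ((2 * k) ^ c) (*-monoˡ-≤ ((4 * k * n) ^ c) (^-monoˡ-≤ c (*-monoʳ-≤ 2 i≤k)))) ⟩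
        2 ^ c * ((2 * k) ^ c * ((2 * k) ^ c * (4 * k * n) ^ c))
          ≡⟨ cong (λ a → 2 ^ c * ((2 * k) ^ c * a)) (sym (^-distribʳ-* c (2 * k) (4 * k * n))) ⟩
        2 ^ c * ((2 * k) ^ c * (2 * k * (4 * k * n)) ^ c)
          ≡⟨ cong (2 ^ c *_) (sym (^-distribʳ-* c (2 * k) (2 * k * (4 * k * n)))) ⟩
        2 ^ c * (2 * k * (2 * k * (4 * k * n))) ^ c
          ≡⟨ sym (^-distribʳ-* c 2 (2 * k * (2 * k * (4 * k * n)))) ⟩
        (2 * (2 * k * (2 * k * (4 * k * n)))) ^ c
          ≡⟨ cong (_^ c) (gather k n) ⟩
        (32 * (k * k * k) * n) ^ c ∎
        where
        open ≤-Reasoning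
        gather : ∀ k n → 2 * (2 * k * (2 * k * (4 * k * n))) ≡ 32 * (k * k * k) * n
        gather = solve-∀

      -- Multiplying by B makes `exchange` and `light-shadow` fit together, and B cancels again.
      -- This is the theorem for a natural N, free of fractions, with a factor 2 to spare.
      shadowSize-bound : 2 * f * Ci * M ≤ (32 * (k * k * k) * n) ^ c * Ck * s
      shadowSize-bound = *-cancelʳ-≤ _ _ B {{>-nonZero (nC-pos (≤-trans (m∸n≤m k c) k≤N))}} (begin
        2 * f * Ci * M * B
          ≡⟨ regroup₁ f Ci M B ⟩
        2 * f * M * (Ci * B)
          ≤⟨ *-monoʳ-≤ (2 * f * M) exchange ⟩
        2 * f * M * ((2 * k) ^ c * (Ca * Ck))
          ≡⟨ regroup₂ f M ((2 * k) ^ c) Ca Ck ⟩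
        2 * (2 * k) ^ c * Ck * (f * (Ca * M))
          ≤⟨ *-monoʳ-≤ (2 * (2 * k) ^ c * Ck) light-shadow ⟩
        2 * (2 * k) ^ c * Ck * ((2 * i) ^ c * ((4 * k * n) ^ c * B) * s)
          ≡⟨ regroup₃ ((2 * k) ^ c) Ck ((2 * i) ^ c) ((4 * k * n) ^ c) B s ⟩
        2 * ((2 * k) ^ c * ((2 * i) ^ c * (4 * k * n) ^ c)) * (Ck * s * B)
          ≤⟨ *-monoˡ-≤ (Ck * s * B) constants ⟩
        (32 * (k * k * k) * n) ^ c * (Ck * s * B)
          ≡⟨ regroup₄ ((32 * (k * k * k) * n) ^ c) Ck s B ⟩
        (32 * (k * k * k) * n) ^ c * Ck * s * B ∎)
        where
        open ≤-Reasoning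
        regroup₁ : ∀ f a m b → 2 * f * a * m * b ≡ 2 * f * m * (a * b)
        regroup₁ = solve-∀
        regroup₂ : ∀ f m p a b → 2 * f * m * (p * (a * b)) ≡ 2 * p * b * (f * (a * m))
        regroup₂ = solve-∀
        regroup₃ : ∀ p a q r b s → 2 * p * a * (q * (r * b) * s) ≡ 2 * (p * (q * r)) * (a * s * b)
        regroup₃ = solve-∀
        regroup₄ : ∀ p a s b → p * (a * s * b) ≡ p * a * s * b
        regroup₄ = solve-∀

  regroup-64k³m : ∀ k m → 32 * (k * k * k) * (2 * m) ≡ 8 * k * (8 * k) * k * m
  regroup-64k³m = solve-∀

-- Rational arithmetic and the passage from N back to x

module Rationals where

  open import Defs
  open Combinatorics using (nC-step; regroup-64k³m)
  open import Data.Integer as ℤ using (+_; -[1+_])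
  import Data.Integer.Properties as ℤ
  open import Data.Nat as ℕ using (ℕ; zero; suc; _∸_)
  open import Data.Nat.Combinatorics using (_C_)
  import Data.Nat.DivMod as ℕ
  import Data.Nat.Properties as ℕ
  open import Data.Product using (_×_; _,_)
  open import Data.Rational as ℚ using (ℚ; mkℚ; 0ℚ; 1ℚ; _+_; _*_; _-_; _≤_; _<_; _/_; floor; toℚᵘ; *≤*; nonNegative; positive)
  open import Data.Rational.Properties
  open import Data.Rational.Solver using (module +-*-Solver)
  open import Data.Rational.Unnormalised as ℚᵘ using (mkℚᵘ)
  import Data.Rational.Unnormalised.Properties as ℚᵘ
  open import Relation.Binary.PropositionalEquality using (_≡_; refl; sym; trans; cong; cong₂; subst; subst₂; module ≡-Reasoning)
  open +-*-Solver using (solve; _:+_; _:*_; _:-_; con; _:=_)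

  -- Naturals in ℚ

  -- `_/_` reduces by the gcd; over unnormalised fractions with denominator 1 the homomorphism laws
  -- become integer identities.
  toℚᵘ-ℕ→ℚ : ∀ m → toℚᵘ (ℕ→ℚ m) ℚᵘ.≃ mkℚᵘ (+ m) 0
  toℚᵘ-ℕ→ℚ m = toℚᵘ-fromℚᵘ (mkℚᵘ (+ m) 0)

  ℕ→ℚ-+ : ∀ a b → ℕ→ℚ (a ℕ.+ b) ≡ ℕ→ℚ a + ℕ→ℚ b
  ℕ→ℚ-+ a b = toℚᵘ-injective (ℚᵘ.≃-trans (toℚᵘ-ℕ→ℚ (a ℕ.+ b)) (ℚᵘ.≃-trans homo
    (ℚᵘ.≃-sym (ℚᵘ.≃-trans (toℚᵘ-homo-+ (ℕ→ℚ a) (ℕ→ℚ b)) (ℚᵘ.+-cong (toℚᵘ-ℕ→ℚ a) (toℚᵘ-ℕ→ℚ b))))))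
    where
    homo : mkℚᵘ (+ (a ℕ.+ b)) 0 ℚᵘ.≃ mkℚᵘ (+ a) 0 ℚᵘ.+ mkℚᵘ (+ b) 0
    homo = ℚᵘ.*≡* (cong (ℤ._* + 1) (cong₂ ℤ._+_ (sym (ℤ.*-identityʳ (+ a))) (sym (ℤ.*-identityʳ (+ b)))))

  ℕ→ℚ-* : ∀ a b → ℕ→ℚ (a ℕ.* b) ≡ ℕ→ℚ a * ℕ→ℚ b
  ℕ→ℚ-* a b = toℚᵘ-injective (ℚᵘ.≃-trans (toℚᵘ-ℕ→ℚ (a ℕ.* b)) (ℚᵘ.≃-trans homo
    (ℚᵘ.≃-sym (ℚᵘ.≃-trans (toℚᵘ-homo-* (ℕ→ℚ a) (ℕ→ℚ b)) (ℚᵘ.*-cong (toℚᵘ-ℕ→ℚ a) (toℚᵘ-ℕ→ℚ b))))))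
    where
    homo : mkℚᵘ (+ (a ℕ.* b)) 0 ℚᵘ.≃ mkℚᵘ (+ a) 0 ℚᵘ.* mkℚᵘ (+ b) 0
    homo = ℚᵘ.*≡* (cong (ℤ._* + 1) (ℤ.pos-* a b))

  ℕ→ℚ-mono : ∀ {a b} → a ℕ.≤ b → ℕ→ℚ a ≤ ℕ→ℚ b
  ℕ→ℚ-mono {a} {b} a≤b = toℚᵘ-cancel-≤ (ℚᵘ.≤-respˡ-≃ (ℚᵘ.≃-sym (toℚᵘ-ℕ→ℚ a)) (ℚᵘ.≤-respʳ-≃ (ℚᵘ.≃-sym (toℚᵘ-ℕ→ℚ b))
    (ℚᵘ.*≤* (ℤ.*-monoʳ-≤-nonNeg (+ 1) (ℤ.+≤+ a≤b)))))

  ℕ→ℚ-cancel : ∀ {a b} → ℕ→ℚ a ≤ ℕ→ℚ b → a ℕ.≤ b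
  ℕ→ℚ-cancel {a} {b} le with ℚᵘ.≤-respˡ-≃ (toℚᵘ-ℕ→ℚ a) (ℚᵘ.≤-respʳ-≃ (toℚᵘ-ℕ→ℚ b) (toℚᵘ-mono-≤ le))
  ... | ℚᵘ.*≤* le′ = ℤ.drop‿+≤+ (subst₂ ℤ._≤_ (ℤ.*-identityʳ (+ a)) (ℤ.*-identityʳ (+ b)) le′)

  0≤ℕ→ℚ : ∀ m → 0ℚ ≤ ℕ→ℚ m
  0≤ℕ→ℚ m = ℕ→ℚ-mono {0} {m} ℕ.z≤n

  0<ℕ→ℚ : ∀ {m} → 0 ℕ.< m → 0ℚ < ℕ→ℚ m
  0<ℕ→ℚ {m} 0<m = ≰⇒> λ le → ℕ.<⇒≱ 0<m (ℕ→ℚ-cancel {m} {0} le)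

  ℕ→ℚ-suc : ∀ m → ℕ→ℚ (suc m) ≡ ℕ→ℚ m + 1ℚ
  ℕ→ℚ-suc m = trans (cong ℕ→ℚ (ℕ.+-comm 1 m)) (ℕ→ℚ-+ m 1)

  -- Ordered field lemmas

  *-monoˡ-≤ : ∀ {p q r} → 0ℚ ≤ r → p ≤ q → r * p ≤ r * q
  *-monoˡ-≤ {r = r} 0≤r p≤q = *-monoˡ-≤-nonNeg r {{nonNegative 0≤r}} p≤q

  *-monoʳ-≤ : ∀ {p q r} → 0ℚ ≤ r → p ≤ q → p * r ≤ q * r
  *-monoʳ-≤ {r = r} 0≤r p≤q = *-monoʳ-≤-nonNeg r {{nonNegative 0≤r}} p≤q

  *-mono-≤ : ∀ {p q r s} → 0ℚ ≤ q → 0ℚ ≤ r → p ≤ q → r ≤ s → p * r ≤ q * s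
  *-mono-≤ 0≤q 0≤r p≤q r≤s = ≤-trans (*-monoʳ-≤ 0≤r p≤q) (*-monoˡ-≤ 0≤q r≤s)

  0≤* : ∀ {p q} → 0ℚ ≤ p → 0ℚ ≤ q → 0ℚ ≤ p * q
  0≤* {p} {q} 0≤p 0≤q = ≤-trans (≤-reflexive (sym (*-zeroʳ p))) (*-monoˡ-≤ 0≤p 0≤q)

  *-cancelʳ-≤ : ∀ {p q r} → 0ℚ < r → p * r ≤ q * r → p ≤ q
  *-cancelʳ-≤ {r = r} 0<r le = *-cancelʳ-≤-pos r {{positive 0<r}} le

  ≤-* : ∀ {p q} → 0ℚ ≤ p → 1ℚ ≤ q → p ≤ p * q
  ≤-* {p} 0≤p 1≤q = ≤-trans (≤-reflexive (sym (*-identityʳ p))) (*-monoˡ-≤ 0≤p 1≤q)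

  0≤- : ∀ {p q} → p ≤ q → 0ℚ ≤ q - p
  0≤- {p} p≤q = ≤-trans (≤-reflexive (sym (+-inverseʳ p))) (+-monoˡ-≤ (ℚ.- p) p≤q)

  0≤^ : ∀ {q} m → 0ℚ ≤ q → 0ℚ ≤ q ^ℚ m
  0≤^ zero    0≤q = 0≤ℕ→ℚ 1
  0≤^ (suc m) 0≤q = 0≤* 0≤q (0≤^ m 0≤q)

  ^-mono-≤ : ∀ {p q} m → 0ℚ ≤ p → p ≤ q → p ^ℚ m ≤ q ^ℚ m
  ^-mono-≤ zero    0≤p p≤q = ≤-refl
  ^-mono-≤ (suc m) 0≤p p≤q = *-mono-≤ (≤-trans 0≤p p≤q) (0≤^ m 0≤p) p≤q (^-mono-≤ m 0≤p p≤q)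

  1≤^ : ∀ {q} m → 1ℚ ≤ q → 1ℚ ≤ q ^ℚ m
  1≤^ zero    1≤q = ≤-refl
  1≤^ {q} (suc m) 1≤q = ≤-trans 1≤q (≤-* (≤-trans (0≤ℕ→ℚ 1) 1≤q) (1≤^ m 1≤q))

  ^-+ : ∀ q a b → q ^ℚ (a ℕ.+ b) ≡ q ^ℚ a * q ^ℚ b
  ^-+ q zero    b = sym (*-identityˡ _)
  ^-+ q (suc a) b = trans (cong (q *_) (^-+ q a b)) (sym (*-assoc q _ _))

  ^-monoʳ-≤ : ∀ {q a b} → 1ℚ ≤ q → a ℕ.≤ b → q ^ℚ a ≤ q ^ℚ b
  ^-monoʳ-≤ {q} {a} {b} 1≤q a≤b = ≤-trans (≤-* (0≤^ a (≤-trans (0≤ℕ→ℚ 1) 1≤q)) (1≤^ (b ∸ a) 1≤q))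
    (≤-reflexive (trans (sym (^-+ q a (b ∸ a))) (cong (q ^ℚ_) (ℕ.m+[n∸m]≡n a≤b))))

  ℕ→ℚ-^ : ∀ a m → ℕ→ℚ (a ℕ.^ m) ≡ ℕ→ℚ a ^ℚ m
  ℕ→ℚ-^ a zero    = refl
  ℕ→ℚ-^ a (suc m) = trans (ℕ→ℚ-* a (a ℕ.^ m)) (cong (ℕ→ℚ a *_) (ℕ→ℚ-^ a m))

  cube-^ : ∀ q r c → (q * q * q * r) ^ℚ c ≡ q ^ℚ (c ℕ.* 3) * r ^ℚ c
  cube-^ q r zero    = refl
  cube-^ q r (suc c) = trans (cong (q * q * q * r *_) (cube-^ q r c))
    (solve 4 (λ q r s t → q :* q :* q :* r :* (s :* t) := q :* (q :* (q :* s)) :* (r :* t)) refl q r (q ^ℚ (c ℕ.* 3)) (r ^ℚ c))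

  /-≤ : ∀ {a d b e} → a ℕ.* suc e ℕ.≤ b ℕ.* suc d → (+ a) / suc d ≤ (+ b) / suc e
  /-≤ {a} {d} {b} {e} le = toℚᵘ-cancel-≤
    (ℚᵘ.≤-respˡ-≃ (ℚᵘ.≃-sym (toℚᵘ-fromℚᵘ (mkℚᵘ (+ a) d))) (ℚᵘ.≤-respʳ-≃ (ℚᵘ.≃-sym (toℚᵘ-fromℚᵘ (mkℚᵘ (+ b) e)))
    (ℚᵘ.*≤* (subst₂ ℤ._≤_ (ℤ.pos-* a (suc e)) (ℤ.pos-* b (suc d)) (ℤ.+≤+ le)))))

  1/suc*suc : ∀ d → (+ 1) / suc d * ℕ→ℚ (suc d) ≡ 1ℚ
  1/suc*suc d = toℚᵘ-injective (ℚᵘ.≃-trans (toℚᵘ-homo-* ((+ 1) / suc d) (ℕ→ℚ (suc d)))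
    (ℚᵘ.≃-trans (ℚᵘ.*-cong (toℚᵘ-fromℚᵘ (mkℚᵘ (+ 1) d)) (toℚᵘ-ℕ→ℚ (suc d))) (ℚᵘ.*≡* eq)))
    where
    eq : (+ 1 ℤ.* + suc d) ℤ.* + 1 ≡ + 1 ℤ.* (+ (suc d ℕ.* 1))
    eq = trans (ℤ.*-identityʳ _) (cong (+ 1 ℤ.*_) (cong +_ (sym (ℕ.*-identityʳ (suc d)))))

  ∣floor∣-bounds : ∀ p → 0ℚ ≤ p → ℕ→ℚ ℤ.∣ floor p ∣ ≤ p × p ≤ ℕ→ℚ (suc ℤ.∣ floor p ∣)
  ∣floor∣-bounds p@(mkℚ -[1+ a ] d _) (*≤* ())
  ∣floor∣-bounds p@(mkℚ (+ a) d _) _ =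
    subst (λ m → ℕ→ℚ m ≤ p × p ≤ ℕ→ℚ (suc m)) (sym ∣floor∣≡) (lower , upper)
    where
    b = a ℕ./ suc d
    ∣floor∣≡ : ℤ.∣ floor p ∣ ≡ b
    ∣floor∣≡ = cong ℤ.∣_∣ (ℤ.*-identityˡ (+ b))
    p≡ : p ≡ (+ a) / suc d
    p≡ = sym (↥p/↧p≡p p)
    lower : ℕ→ℚ b ≤ p
    lower = ≤-trans (/-≤ {b} {0} {a} {d} (ℕ.≤-trans (ℕ.m/n*n≤m a (suc d)) (ℕ.≤-reflexive (sym (ℕ.*-identityʳ a))))) (≤-reflexive (sym p≡))
    upper : p ≤ ℕ→ℚ (suc b)
    upper = ≤-trans (≤-reflexive p≡) (/-≤ {a} {d} {suc b} {0} (begin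
      a ℕ.* 1                          ≡⟨ ℕ.*-identityʳ a ⟩
      a                                ≡⟨ ℕ.m≡m%n+[m/n]*n a (suc d) ⟩
      a ℕ.% suc d ℕ.+ b ℕ.* suc d      ≤⟨ ℕ.+-monoˡ-≤ (b ℕ.* suc d) (ℕ.m%n≤n a (suc d)) ⟩
      suc b ℕ.* suc d                  ∎))
      where open ℕ.≤-Reasoning

  -- Binomial coefficients with rational upper argument

  binomQ-ℕ : ∀ N j → j ℕ.≤ N → binomQ (ℕ→ℚ N) j ≡ ℕ→ℚ (N C j)
  binomQ-ℕ N zero    _   = refl
  binomQ-ℕ N (suc j) j<N = begin
    binomQ (ℕ→ℚ N) j * (ℕ→ℚ N - ℕ→ℚ j) * w
      ≡⟨ cong₂ (λ a b → a * b * w) (binomQ-ℕ N j (ℕ.<⇒≤ j<N)) diff ⟩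
    ℕ→ℚ (N C j) * ℕ→ℚ (N ∸ j) * w
      ≡⟨ cong (_* w) (trans (*-comm (ℕ→ℚ (N C j)) _) (sym (ℕ→ℚ-* (N ∸ j) (N C j)))) ⟩
    ℕ→ℚ ((N ∸ j) ℕ.* (N C j)) * w
      ≡⟨ cong (λ a → ℕ→ℚ a * w) (sym (nC-step (ℕ.<⇒≤ j<N))) ⟩
    ℕ→ℚ (suc j ℕ.* (N C suc j)) * w
      ≡⟨ cong (_* w) (ℕ→ℚ-* (suc j) (N C suc j)) ⟩
    ℕ→ℚ (suc j) * ℕ→ℚ (N C suc j) * w
      ≡⟨ solve 3 (λ s b w → s :* b :* w := w :* s :* b) refl (ℕ→ℚ (suc j)) (ℕ→ℚ (N C suc j)) w ⟩
    w * ℕ→ℚ (suc j) * ℕ→ℚ (N C suc j)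
      ≡⟨ cong (_* ℕ→ℚ (N C suc j)) (1/suc*suc j) ⟩
    1ℚ * ℕ→ℚ (N C suc j)
      ≡⟨ *-identityˡ _ ⟩
    ℕ→ℚ (N C suc j) ∎
    where
    open ≡-Reasoning
    w = (+ 1) / suc j
    diff : ℕ→ℚ N - ℕ→ℚ j ≡ ℕ→ℚ (N ∸ j)
    diff = trans (cong (λ a → ℕ→ℚ a - ℕ→ℚ j) (sym (ℕ.m∸n+n≡m (ℕ.<⇒≤ j<N))))
      (trans (cong (_- ℕ→ℚ j) (ℕ→ℚ-+ (N ∸ j) j)) (solve 2 (λ a b → a :+ b :- b := a) refl (ℕ→ℚ (N ∸ j)) (ℕ→ℚ j)))

  0≤1/suc : ∀ j → 0ℚ ≤ (+ 1) / suc j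
  0≤1/suc j = /-≤ {0} {0} {1} {j} ℕ.z≤n

  module _ {k : ℕ} {x : ℚ} (2k≤x : ℕ→ℚ (2 ℕ.* k) ≤ x) where

    j≤x : ∀ {j} → j ℕ.≤ k → ℕ→ℚ j ≤ x
    j≤x j≤k = ≤-trans (ℕ→ℚ-mono (ℕ.≤-trans j≤k (ℕ.m≤m+n k _))) 2k≤x

    0≤binomQ : ∀ {j} → j ℕ.≤ k → 0ℚ ≤ binomQ x j
    0≤binomQ {zero}  _   = 0≤ℕ→ℚ 1
    0≤binomQ {suc j} j<k = 0≤* (0≤* (0≤binomQ (ℕ.<⇒≤ j<k)) (0≤- (j≤x (ℕ.<⇒≤ j<k)))) (0≤1/suc j)

    binomQ-monoˡ : ∀ {y j} → x ≤ y → j ℕ.≤ k → binomQ x j ≤ binomQ y j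
    binomQ-monoˡ {y} {zero}  x≤y _   = ≤-refl
    binomQ-monoˡ {y} {suc j} x≤y j<k = *-monoʳ-≤ (0≤1/suc j)
      (*-mono-≤ (≤-trans (0≤binomQ j≤k) ih) (0≤- (j≤x j≤k)) ih (+-monoˡ-≤ (ℚ.- ℕ→ℚ j) x≤y))
      where
      j≤k = ℕ.<⇒≤ j<k
      ih = binomQ-monoˡ {y} {j} x≤y j≤k

    -- Each step multiplies by (x-j)/(j+1), which is at least 1 because 2j + 1 ≤ 2k ≤ x.
    binomQ-monoʳ : ∀ {i j} → i ℕ.≤′ j → j ℕ.≤ k → binomQ x i ≤ binomQ x j
    binomQ-monoʳ (ℕ.≤′-reflexive refl) _   = ≤-refl
    binomQ-monoʳ {i} {suc j} (ℕ.≤′-step i≤j) j<k = ≤-trans (binomQ-monoʳ i≤j (ℕ.<⇒≤ j<k))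
      (≤-trans (≤-* (0≤binomQ (ℕ.<⇒≤ j<k)) (begin
          1ℚ                                   ≡⟨ sym (1/suc*suc j) ⟩
          w * ℕ→ℚ (suc j)                      ≤⟨ *-monoˡ-≤ (0≤1/suc j) 1+j≤x-j ⟩
          w * (x - ℕ→ℚ j)                      ≡⟨ *-comm w _ ⟩
          (x - ℕ→ℚ j) * w                      ∎))
        (≤-reflexive (sym (*-assoc (binomQ x j) _ w))))
      where
      open ≤-Reasoning
      w = (+ 1) / suc j
      1+j≤x-j : ℕ→ℚ (suc j) ≤ x - ℕ→ℚ j
      1+j≤x-j = begin
        ℕ→ℚ (suc j)                            ≡⟨ solve 2 (λ a b → a := a :+ b :- b) refl (ℕ→ℚ (suc j)) (ℕ→ℚ j) ⟩
        ℕ→ℚ (suc j) + ℕ→ℚ j - ℕ→ℚ j            ≡⟨ cong (_- ℕ→ℚ j) (sym (ℕ→ℚ-+ (suc j) j)) ⟩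
        ℕ→ℚ (suc j ℕ.+ j) - ℕ→ℚ j              ≤⟨ +-monoˡ-≤ (ℚ.- ℕ→ℚ j) (≤-trans (ℕ→ℚ-mono (ℕ.+-mono-≤ j<k (ℕ.≤-trans (ℕ.<⇒≤ j<k) (ℕ.m≤m+n k 0)))) 2k≤x) ⟩
        x - ℕ→ℚ j                              ∎

    -- Rounding the upper argument up to y ≤ x + 1 multiplies C(x,j)/C(x,i) by a product of factors
    -- 1 + 1/(x-l) ≤ (2k-l+1)/(2k-l), which telescopes.
    binomQ-round : ∀ {y i j} → x ≤ y → y ≤ x + 1ℚ → i ℕ.≤′ j → j ℕ.≤ k →
      binomQ x i * binomQ y j * (ℕ→ℚ (2 ℕ.* k) - ℕ→ℚ j + 1ℚ) ≤ (ℕ→ℚ (2 ℕ.* k) - ℕ→ℚ i + 1ℚ) * (binomQ x j * binomQ y i)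
    binomQ-round {y} {i} x≤y y≤x+1 (ℕ.≤′-reflexive refl) _ =
      ≤-reflexive (*-comm (binomQ x i * binomQ y i) _)
    binomQ-round {y} {i} {suc j} x≤y y≤x+1 (ℕ.≤′-step i≤j) j<k = begin
      bi * (βj * (y - J) * w) * (K - ℕ→ℚ (suc j) + 1ℚ)
        ≡⟨ cong (λ s → bi * (βj * (y - J) * w) * (K - s + 1ℚ)) (ℕ→ℚ-suc j) ⟩
      bi * (βj * (y - J) * w) * (K - (J + 1ℚ) + 1ℚ)
        ≡⟨ solve 6 (λ bi βj y J w K → bi :* (βj :* (y :- J) :* w) :* (K :- (J :+ con 1ℚ) :+ con 1ℚ) := bi :* βj :* w :* ((y :- J) :* (K :- J))) refl bi βj y J w K ⟩
      bi * βj * w * ((y - J) * (K - J))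
        ≤⟨ *-monoˡ-≤ (0≤* (0≤* (0≤binomQ i≤k) (≤-trans (0≤binomQ j≤k) (binomQ-monoˡ x≤y j≤k))) (0≤1/suc j)) factor ⟩
      bi * βj * w * ((K - J + 1ℚ) * (x - J))
        ≡⟨ solve 6 (λ bi βj x J w K → bi :* βj :* w :* ((K :- J :+ con 1ℚ) :* (x :- J)) := bi :* βj :* (K :- J :+ con 1ℚ) :* ((x :- J) :* w)) refl bi βj x J w K ⟩
      bi * βj * (K - J + 1ℚ) * ((x - J) * w)
        ≤⟨ *-monoʳ-≤ (0≤* (0≤- (j≤x j≤k)) (0≤1/suc j)) (binomQ-round x≤y y≤x+1 i≤j j≤k) ⟩
      (K - ℕ→ℚ i + 1ℚ) * (bj * βi) * ((x - J) * w)
        ≡⟨ solve 5 (λ c bj βi d w → c :* (bj :* βi) :* (d :* w) := c :* (bj :* d :* w :* βi)) refl (K - ℕ→ℚ i + 1ℚ) bj βi (x - J) w ⟩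
      (K - ℕ→ℚ i + 1ℚ) * (bj * (x - J) * w * βi) ∎
      where
      open ≤-Reasoning
      j≤k = ℕ.<⇒≤ j<k
      i≤k = ℕ.≤-trans (ℕ.≤′⇒≤ i≤j) j≤k
      K = ℕ→ℚ (2 ℕ.* k)
      J = ℕ→ℚ j
      w = (+ 1) / suc j
      bi = binomQ x i
      bj = binomQ x j
      βi = binomQ y i
      βj = binomQ y j
      factor : (y - J) * (K - J) ≤ (K - J + 1ℚ) * (x - J)
      factor = begin
        (y - J) * (K - J)
          ≤⟨ *-monoʳ-≤ (0≤- (ℕ→ℚ-mono (ℕ.≤-trans j≤k (ℕ.m≤m+n k _)))) (+-monoˡ-≤ (ℚ.- J) y≤x+1) ⟩
        (x + 1ℚ - J) * (K - J)
          ≡⟨ solve 3 (λ x J K → (x :+ con 1ℚ :- J) :* (K :- J) := (x :- J) :* (K :- J) :+ (K :- J)) refl x J K ⟩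
        (x - J) * (K - J) + (K - J)
          ≤⟨ +-monoʳ-≤ ((x - J) * (K - J)) (+-monoˡ-≤ (ℚ.- J) 2k≤x) ⟩
        (x - J) * (K - J) + (x - J)
          ≡⟨ solve 3 (λ x J K → (x :- J) :* (K :- J) :+ (x :- J) := (K :- J :+ con 1ℚ) :* (x :- J)) refl x J K ⟩
        (K - J + 1ℚ) * (x - J) ∎

    -- The telescoped product is (2k-i+1)/(k+1), which is at most 2.
    binomQ-round-≤ : ∀ {y i} → x ≤ y → y ≤ x + 1ℚ → i ℕ.≤ k →
      binomQ x i * binomQ y k ≤ ℕ→ℚ 2 * (binomQ x k * binomQ y i)
    binomQ-round-≤ {y} {i} x≤y y≤x+1 i≤k = *-cancelʳ-≤ (0<ℕ→ℚ {suc k} (ℕ.s≤s ℕ.z≤n)) (begin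
      binomQ x i * binomQ y k * ℕ→ℚ (suc k)
        ≡⟨ cong (binomQ x i * binomQ y k *_) (sym K-k+1) ⟩
      binomQ x i * binomQ y k * (K - ℕ→ℚ k + 1ℚ)
        ≤⟨ binomQ-round x≤y y≤x+1 (ℕ.≤⇒≤′ i≤k) ℕ.≤-refl ⟩
      (K - ℕ→ℚ i + 1ℚ) * (binomQ x k * binomQ y i)
        ≤⟨ *-monoʳ-≤ (0≤* (0≤binomQ ℕ.≤-refl) (≤-trans (0≤binomQ i≤k) (binomQ-monoˡ x≤y i≤k))) K-i+1 ⟩
      ℕ→ℚ 2 * ℕ→ℚ (suc k) * (binomQ x k * binomQ y i)
        ≡⟨ solve 3 (λ a b c → a :* b :* c := a :* c :* b) refl (ℕ→ℚ 2) (ℕ→ℚ (suc k)) (binomQ x k * binomQ y i) ⟩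
      ℕ→ℚ 2 * (binomQ x k * binomQ y i) * ℕ→ℚ (suc k) ∎)
      where
      open ≤-Reasoning
      K = ℕ→ℚ (2 ℕ.* k)
      K-k+1 : K - ℕ→ℚ k + 1ℚ ≡ ℕ→ℚ (suc k)
      K-k+1 = trans (cong (λ a → a - ℕ→ℚ k + 1ℚ) (trans (ℕ→ℚ-+ k (k ℕ.+ 0)) (cong (λ a → ℕ→ℚ k + ℕ→ℚ a) (ℕ.+-identityʳ k))))
        (trans (solve 1 (λ a → a :+ a :- a :+ con 1ℚ := a :+ con 1ℚ) refl (ℕ→ℚ k)) (sym (ℕ→ℚ-suc k)))
      K-i+1 : K - ℕ→ℚ i + 1ℚ ≤ ℕ→ℚ 2 * ℕ→ℚ (suc k)
      K-i+1 = begin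
        K - ℕ→ℚ i + 1ℚ          ≤⟨ +-monoˡ-≤ 1ℚ (≤-trans (+-monoʳ-≤ K (neg-antimono-≤ (0≤ℕ→ℚ i))) (≤-reflexive (+-identityʳ K))) ⟩
        K + 1ℚ                  ≡⟨ sym (ℕ→ℚ-suc (2 ℕ.* k)) ⟩
        ℕ→ℚ (suc (2 ℕ.* k))     ≤⟨ ℕ→ℚ-mono (ℕ.≤-trans (ℕ.n≤1+n _) (ℕ.≤-reflexive (sym (ℕ.*-suc 2 k)))) ⟩
        ℕ→ℚ (2 ℕ.* suc k)       ≡⟨ ℕ→ℚ-* 2 (suc k) ⟩
        ℕ→ℚ 2 * ℕ→ℚ (suc k)     ∎

  -- Assembling the constant

  ℕ→ℚ-*³ : ∀ a b c → ℕ→ℚ (a ℕ.* b ℕ.* c) ≡ ℕ→ℚ a * ℕ→ℚ b * ℕ→ℚ c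
  ℕ→ℚ-*³ a b c = trans (ℕ→ℚ-* (a ℕ.* b) c) (cong (_* ℕ→ℚ c) (ℕ→ℚ-* a b))

  ℕ→ℚ-*⁴ : ∀ a b c d → ℕ→ℚ (a ℕ.* b ℕ.* c ℕ.* d) ≡ ℕ→ℚ a * ℕ→ℚ b * ℕ→ℚ c * ℕ→ℚ d
  ℕ→ℚ-*⁴ a b c d = trans (ℕ→ℚ-* (a ℕ.* b ℕ.* c) d) (cong (_* ℕ→ℚ d) (ℕ→ℚ-*³ a b c))

  -- Transfers an inequality for C(N,i)/C(N,k) with N natural to the rational ratio b/b′ = C(x,i)/C(x,k).
  transfer : ∀ {b b′ E} f s β β′ M R → 0ℚ ≤ b′ → 0 ℕ.< β′ → 0 ℕ.< M →
    b * ℕ→ℚ β′ ≤ ℕ→ℚ 2 * (b′ * ℕ→ℚ β) → 2 ℕ.* f ℕ.* β ℕ.* M ℕ.≤ R ℕ.* β′ ℕ.* s → ℕ→ℚ R ≤ E * ℕ→ℚ M →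
    b * ℕ→ℚ f ≤ E * b′ * ℕ→ℚ s
  transfer {b} {b′} {E} f s β β′ M R 0≤b′ 0<β′ 0<M ratio nat R≤ =
    *-cancelʳ-≤ (0<ℕ→ℚ 0<M) (*-cancelʳ-≤ (0<ℕ→ℚ 0<β′) (begin
      b * ℕ→ℚ f * ℕ→ℚ M * ℕ→ℚ β′
        ≡⟨ solve 4 (λ b f m c → b :* f :* m :* c := b :* c :* (f :* m)) refl b (ℕ→ℚ f) (ℕ→ℚ M) (ℕ→ℚ β′) ⟩
      b * ℕ→ℚ β′ * (ℕ→ℚ f * ℕ→ℚ M)
        ≤⟨ *-monoʳ-≤ (0≤* (0≤ℕ→ℚ f) (0≤ℕ→ℚ M)) ratio ⟩
      ℕ→ℚ 2 * (b′ * ℕ→ℚ β) * (ℕ→ℚ f * ℕ→ℚ M)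
        ≡⟨ solve 5 (λ t b c f m → t :* (b :* c) :* (f :* m) := b :* (t :* f :* c :* m)) refl (ℕ→ℚ 2) b′ (ℕ→ℚ β) (ℕ→ℚ f) (ℕ→ℚ M) ⟩
      b′ * (ℕ→ℚ 2 * ℕ→ℚ f * ℕ→ℚ β * ℕ→ℚ M)
        ≡⟨ cong (b′ *_) (sym (ℕ→ℚ-*⁴ 2 f β M)) ⟩
      b′ * ℕ→ℚ (2 ℕ.* f ℕ.* β ℕ.* M)
        ≤⟨ *-monoˡ-≤ 0≤b′ (ℕ→ℚ-mono nat) ⟩
      b′ * ℕ→ℚ (R ℕ.* β′ ℕ.* s)
        ≡⟨ cong (b′ *_) (ℕ→ℚ-*³ R β′ s) ⟩
      b′ * (ℕ→ℚ R * ℕ→ℚ β′ * ℕ→ℚ s)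
        ≤⟨ *-monoˡ-≤ 0≤b′ (*-monoʳ-≤ (0≤ℕ→ℚ s) (*-monoʳ-≤ (0≤ℕ→ℚ β′) R≤)) ⟩
      b′ * (E * ℕ→ℚ M * ℕ→ℚ β′ * ℕ→ℚ s)
        ≡⟨ solve 5 (λ b e m c s → b :* (e :* m :* c :* s) := e :* b :* s :* m :* c) refl b′ E (ℕ→ℚ M) (ℕ→ℚ β′) (ℕ→ℚ s) ⟩
      E * b′ * ℕ→ℚ s * ℕ→ℚ M * ℕ→ℚ β′ ∎))
    where open ≤-Reasoning

  -- As 32 k^3 · 2m = (8k)(8k)k m, the bound on n brings in one factor y = 1/α; y ≥ 1 and k ≤ 8k
  -- raise the rest to the cube of Q.
  32k³n≤Q³m : ∀ {y} k m n → 1ℚ ≤ y → ℕ→ℚ n ≤ ℕ→ℚ (2 ℕ.* m) * y → let Q = ℕ→ℚ (8 ℕ.* k) * y in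
    ℕ→ℚ (32 ℕ.* (k ℕ.* k ℕ.* k) ℕ.* n) ≤ Q * Q * Q * ℕ→ℚ m
  32k³n≤Q³m {y} k m n 1≤y n≤2my = begin
    ℕ→ℚ (a ℕ.* n)                                   ≡⟨ ℕ→ℚ-* a n ⟩
    ℕ→ℚ a * ℕ→ℚ n                                   ≤⟨ *-monoˡ-≤ (0≤ℕ→ℚ a) n≤2my ⟩
    ℕ→ℚ a * (ℕ→ℚ (2 ℕ.* m) * y)                     ≡⟨ sym (*-assoc (ℕ→ℚ a) (ℕ→ℚ (2 ℕ.* m)) y) ⟩
    ℕ→ℚ a * ℕ→ℚ (2 ℕ.* m) * y                       ≡⟨ cong (_* y) (sym (ℕ→ℚ-* a (2 ℕ.* m))) ⟩
    ℕ→ℚ (a ℕ.* (2 ℕ.* m)) * y                       ≡⟨ cong (λ b → ℕ→ℚ b * y) (regroup-64k³m k m) ⟩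
    ℕ→ℚ (8 ℕ.* k ℕ.* (8 ℕ.* k) ℕ.* k ℕ.* m) * y     ≡⟨ cong (_* y) (ℕ→ℚ-*⁴ (8 ℕ.* k) (8 ℕ.* k) k m) ⟩
    e * e * ℕ→ℚ k * ℕ→ℚ m * y                       ≡⟨ solve 4 (λ e k m y → e :* e :* k :* m :* y := e :* y :* e :* k :* m) refl e (ℕ→ℚ k) (ℕ→ℚ m) y ⟩
    Q * e * ℕ→ℚ k * ℕ→ℚ m                           ≤⟨ *-monoʳ-≤ (0≤ℕ→ℚ m) (*-mono-≤ (0≤* 0≤Q 0≤Q) (0≤ℕ→ℚ k) (*-monoˡ-≤ 0≤Q e≤Q) k≤Q) ⟩
    Q * Q * Q * ℕ→ℚ m                               ∎
    where
    open ≤-Reasoning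
    a = 32 ℕ.* (k ℕ.* k ℕ.* k)
    e = ℕ→ℚ (8 ℕ.* k)
    Q = e * y
    e≤Q : e ≤ Q
    e≤Q = ≤-* (0≤ℕ→ℚ (8 ℕ.* k)) 1≤y
    0≤Q : 0ℚ ≤ Q
    0≤Q = ≤-trans (0≤ℕ→ℚ (8 ℕ.* k)) e≤Q
    k≤Q : ℕ→ℚ k ≤ Q
    k≤Q = ≤-trans (ℕ→ℚ-mono (ℕ.m≤n*m k 8)) e≤Q

  ^-≤-cube : ∀ {q} t m {c e} → 1ℚ ≤ q → ℕ→ℚ t ≤ q * q * q * ℕ→ℚ m → c ℕ.* 3 ℕ.≤ e →
    ℕ→ℚ (t ℕ.^ c) ≤ q ^ℚ e * ℕ→ℚ (m ℕ.^ c)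
  ^-≤-cube {q} t m {c} {e} 1≤q t≤ 3c≤e = begin
    ℕ→ℚ (t ℕ.^ c)                       ≡⟨ ℕ→ℚ-^ t c ⟩
    ℕ→ℚ t ^ℚ c                          ≤⟨ ^-mono-≤ c (0≤ℕ→ℚ t) t≤ ⟩
    (q * q * q * ℕ→ℚ m) ^ℚ c            ≡⟨ cube-^ q (ℕ→ℚ m) c ⟩
    q ^ℚ (c ℕ.* 3) * ℕ→ℚ m ^ℚ c         ≡⟨ cong (q ^ℚ (c ℕ.* 3) *_) (sym (ℕ→ℚ-^ m c)) ⟩
    q ^ℚ (c ℕ.* 3) * ℕ→ℚ (m ℕ.^ c)      ≤⟨ *-monoʳ-≤ (0≤ℕ→ℚ (m ℕ.^ c)) (^-monoʳ-≤ 1≤q 3c≤e) ⟩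
    q ^ℚ e * ℕ→ℚ (m ℕ.^ c)              ∎
    where open ≤-Reasoning

  2*½ : ∀ {a b} → ℕ→ℚ a ≤ ℚ.½ * ℕ→ℚ b → 2 ℕ.* a ℕ.≤ b
  2*½ {a} {b} le = ℕ→ℚ-cancel {2 ℕ.* a} {b} (begin
    ℕ→ℚ (2 ℕ.* a)              ≡⟨ ℕ→ℚ-* 2 a ⟩
    ℕ→ℚ 2 * ℕ→ℚ a              ≤⟨ *-monoˡ-≤ (0≤ℕ→ℚ 2) le ⟩
    ℕ→ℚ 2 * (ℚ.½ * ℕ→ℚ b)      ≡⟨ sym (*-assoc (ℕ→ℚ 2) ℚ.½ (ℕ→ℚ b)) ⟩
    1ℚ * ℕ→ℚ b                 ≡⟨ *-identityˡ (ℕ→ℚ b) ⟩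
    ℕ→ℚ b                      ∎)
    where open ≤-Reasoning

  -- 2^(w+1) ≤ n^(w+1) ≤ 2^u forces w + 1 ≤ u.
  1≤log : ∀ n u w → 2 ℕ.≤ n → n ℕ.^ suc w ℕ.≤ 2 ℕ.^ u → 1ℚ ≤ (+ u) / suc w
  1≤log n u w 2≤n le = /-≤ {1} {0} {u} {w}
    (ℕ.≤-trans (ℕ.≤-reflexive (ℕ.*-identityˡ _)) (ℕ.≤-trans w<u (ℕ.≤-reflexive (sym (ℕ.*-identityʳ u)))))
    where
    w<u : suc w ℕ.≤ u
    w<u = ℕ.≮⇒≥ λ u≤w → ℕ.<⇒≱ (ℕ.^-monoʳ-< 2 (ℕ.s≤s (ℕ.s≤s ℕ.z≤n)) u≤w) (ℕ.≤-trans (ℕ.^-monoˡ-≤ (suc w) 2≤n) le)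

-- Deduction of the theorem

open import Defs
open Combinatorics using (nC-pos; shadowSize-pos; shadowSize-bound; exponent-bound)
open Rationals
open import Data.Nat as ℕ using (ℕ; _∸_)
open import Data.Integer as ℤ using ()
open import Data.Rational as ℚ using (ℚ; 0ℚ; 1ℚ; _*_; _≤_; _<_; 1/_; floor; >-nonZero; ½)
open import Data.List using (length)
open import Data.List.Relation.Unary.All using (All)
open import Data.List.Relation.Unary.Unique.Propositional using (Unique)
open import Data.Fin.Subset using (∣_∣)
open import Relation.Binary.PropositionalEquality using (_≡_)
open import Data.Empty using (⊥-elim)
open import Data.Nat.Combinatorics using (_C_)
import Data.Nat.Properties as ℕ
open import Data.Product using (proj₁; proj₂)
open import Data.Rational using (_+_)
open import Data.Rational.Properties using (≤-trans; ≤-reflexive; *-comm; *-assoc; *-identityˡ; *-identityʳ; *-inverseˡ; positive⁻¹; 1/pos⇒pos; <⇒≤; +-monoˡ-≤; module ≤-Reasoning)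
open import Relation.Binary.PropositionalEquality using (refl; sym; trans; cong)
open import Relation.Nullary using (Dec; yes; no)

theorem1p6 :
  (α : ℚ) (α>0 : 0ℚ < α) → α ≤ 1ℚ →
  (n k : ℕ) → 2 ℕ.≤ n →
  (F : Hypergraph n) → Unique F → All (λ e → ∣ e ∣ ≡ k) F →
  -- r ≥ 1, where |F| = n^r
  n ℕ.≤ length F →
  -- c = ⌈r⌉ : least c with |F| ≤ n^c
  (c : ℕ) → length F ℕ.≤ n ℕ.^ c → ((m : ℕ) → length F ℕ.≤ n ℕ.^ m → c ℕ.≤ m) →
  -- c5 = ⌈5r⌉ : least c5 with |F|^5 ≤ n^c5
  (c5 : ℕ) → length F ℕ.^ 5 ℕ.≤ n ℕ.^ c5 → ((m : ℕ) → length F ℕ.^ 5 ℕ.≤ n ℕ.^ m → c5 ℕ.≤ m) →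
  (x : ℚ) → ℕ→ℚ (2 ℕ.* k) ≤ x →
  ℕ→ℚ (wp F ℤ.∣ floor (α * ℕ→ℚ n) ∣) ≤ binomQ x (k ∸ c) * ℕ→ℚ n →
  ℕ→ℚ (wp F ℤ.∣ floor (α * ℕ→ℚ n) ∣) ≤ ½ * ℕ→ℚ (length F) →
  (i : ℕ) → 1 ℕ.≤ i → length F ℕ.≤ n ℕ.^ (i ∸ 1) → i ℕ.≤ k →
  -- binom(x,i) |F| ≤ C · binom(x,k) · |∂_i F|, C = (8k/α)^c5 · log₂ n
  LeTimesLog2 n
    ((ℕ→ℚ (8 ℕ.* k) * (1/_ α {{>-nonZero α>0}})) ^ℚ c5 * binomQ x k * ℕ→ℚ (shadowSize F i))
    (binomQ x i * ℕ→ℚ (length F))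
-- ⌈r⌉ = 0 would mean |F| ≤ 1, against 2 ≤ n ≤ |F|.
theorem1p6 α α>0 α≤1 n k 2≤n F uniq uniform n≤f ℕ.zero f≤ _ =
  ⊥-elim (ℕ.<⇒≱ 2≤n (ℕ.≤-trans n≤f f≤))
theorem1p6 α α>0 α≤1 n k 2≤n F uniq uniform n≤f c@(ℕ.suc c′) f≤n^c c-least c5 f⁵≤ _
  x 2k≤x wp≤ wp≤½ i@(ℕ.suc i′) _ f≤n^i′ i≤k u w n^≤2^ =
    ≤-trans (bound (8 ℕ.* k ℕ.≤? m)) (≤-* (0≤* (0≤* (0≤^ c5 0≤Q) 0≤bk) (0≤ℕ→ℚ s)) (1≤log n u w 2≤n n^≤2^))
  where
  f = length F
  s = shadowSize F i
  m = ℤ.∣ floor (α * ℕ→ℚ n) ∣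
  y = 1/_ α {{>-nonZero α>0}}
  Q = ℕ→ℚ (8 ℕ.* k) * y
  bi = binomQ x i
  bk = binomQ x k

  0≤α = <⇒≤ α>0
  0≤y : 0ℚ ≤ y
  0≤y = <⇒≤ (positive⁻¹ y {{1/pos⇒pos α {{ℚ.positive α>0}}}})
  yα≡1 : y * α ≡ 1ℚ
  yα≡1 = *-inverseˡ α {{>-nonZero α>0}}
  1≤y : 1ℚ ≤ y
  1≤y = ≤-trans (≤-reflexive (sym yα≡1)) (≤-trans (*-monoˡ-≤ 0≤y α≤1) (≤-reflexive (*-identityʳ y)))
  0≤Q : 0ℚ ≤ Q
  0≤Q = 0≤* (0≤ℕ→ℚ (8 ℕ.* k)) 0≤y
  0≤bk = 0≤binomQ {k} 2k≤x {k} ℕ.≤-refl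

  0≤αn = 0≤* 0≤α (0≤ℕ→ℚ n)
  m≤αn : ℕ→ℚ m ≤ α * ℕ→ℚ n
  m≤αn = proj₁ (∣floor∣-bounds (α * ℕ→ℚ n) 0≤αn)
  αn≤1+m : α * ℕ→ℚ n ≤ ℕ→ℚ (ℕ.suc m)
  αn≤1+m = proj₂ (∣floor∣-bounds (α * ℕ→ℚ n) 0≤αn)
  m≤n : m ℕ.≤ n
  m≤n = ℕ→ℚ-cancel (≤-trans m≤αn (≤-trans (*-monoʳ-≤ (0≤ℕ→ℚ n) α≤1) (≤-reflexive (*-identityˡ _))))
  n≤ : ∀ {a} → ℕ.suc m ℕ.≤ a → ℕ→ℚ n ≤ ℕ→ℚ a * y
  n≤ {a} m<a = begin
    ℕ→ℚ n                  ≡⟨ trans (sym (*-identityˡ _)) (cong (_* ℕ→ℚ n) (sym yα≡1)) ⟩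
    y * α * ℕ→ℚ n          ≡⟨ *-assoc y α (ℕ→ℚ n) ⟩
    y * (α * ℕ→ℚ n)        ≤⟨ *-monoˡ-≤ 0≤y (≤-trans αn≤1+m (ℕ→ℚ-mono m<a)) ⟩
    y * ℕ→ℚ a              ≡⟨ *-comm y (ℕ→ℚ a) ⟩
    ℕ→ℚ a * y              ∎
    where open ≤-Reasoning

  1≤f : 1 ℕ.≤ f
  1≤f = ℕ.≤-trans (ℕ.≤-trans (ℕ.n≤1+n 1) 2≤n) n≤f
  -- `r + 1 ≤ i` is given as |F| ≤ n^(i-1), so minimality of c yields c ≤ i - 1.
  c<i : c ℕ.< i
  c<i = ℕ.s≤s (c-least i′ f≤n^i′)
  1≤k : 1 ℕ.≤ k
  1≤k = ℕ.≤-trans (ℕ.s≤s ℕ.z≤n) i≤k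

  -- When αn < 8k the constant alone exceeds |F|.
  small-m : m ℕ.< 8 ℕ.* k → bi * ℕ→ℚ f ≤ Q ^ℚ c5 * bk * ℕ→ℚ s
  small-m m<8k = begin
    bi * ℕ→ℚ f                 ≤⟨ *-mono-≤ 0≤bk (0≤ℕ→ℚ f) (binomQ-monoʳ {k} 2k≤x (ℕ.≤⇒≤′ i≤k) ℕ.≤-refl) f≤Q^c5 ⟩
    bk * Q ^ℚ c5               ≡⟨ *-comm bk (Q ^ℚ c5) ⟩
    Q ^ℚ c5 * bk               ≤⟨ ≤-* (0≤* (0≤^ c5 0≤Q) 0≤bk) (ℕ→ℚ-mono {1} {s} (shadowSize-pos F uniq uniform i≤k 1≤f)) ⟩
    Q ^ℚ c5 * bk * ℕ→ℚ s       ∎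
    where
    open ≤-Reasoning
    f≤Q^c5 : ℕ→ℚ f ≤ Q ^ℚ c5
    f≤Q^c5 = begin
      ℕ→ℚ f              ≤⟨ ℕ→ℚ-mono (ℕ.≤-trans (ℕ.m≤m*n f (f ℕ.^ 4) {{ℕ.m^n≢0 f 4 {{ℕ.>-nonZero 1≤f}}}}) f⁵≤) ⟩
      ℕ→ℚ (n ℕ.^ c5)     ≡⟨ ℕ→ℚ-^ n c5 ⟩
      ℕ→ℚ n ^ℚ c5        ≤⟨ ^-mono-≤ c5 (0≤ℕ→ℚ n) (n≤ m<8k) ⟩
      Q ^ℚ c5            ∎

  large-m : 8 ℕ.* k ℕ.≤ m → bi * ℕ→ℚ f ≤ Q ^ℚ c5 * bk * ℕ→ℚ s
  large-m 8k≤m = transfer {bi} {bk} {Q ^ℚ c5} f s Ci Ck M (T ℕ.^ c) 0≤bk (nC-pos k≤N) (ℕ.m^n>0 m {{ℕ.>-nonZero 1≤m}} c) round core T^c≤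
    where
    open ≤-Reasoning
    -- Rounding up rather than down preserves the sparsity hypothesis, since C(x, k-c) ≤ C(N, k-c);
    -- `round` bounds the cost.
    N = ℕ.suc ℤ.∣ floor x ∣
    0≤x = ≤-trans (0≤ℕ→ℚ (2 ℕ.* k)) 2k≤x
    x≤N : x ≤ ℕ→ℚ N
    x≤N = proj₂ (∣floor∣-bounds x 0≤x)
    N≤x+1 : ℕ→ℚ N ≤ x + 1ℚ
    N≤x+1 = ≤-trans (≤-reflexive (ℕ→ℚ-suc ℤ.∣ floor x ∣)) (+-monoˡ-≤ 1ℚ (proj₁ (∣floor∣-bounds x 0≤x)))
    2k≤N : 2 ℕ.* k ℕ.≤ N
    2k≤N = ℕ→ℚ-cancel (≤-trans 2k≤x x≤N)
    k≤N : k ℕ.≤ N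
    k≤N = ℕ.≤-trans (ℕ.m≤m+n k _) 2k≤N
    1≤m : 1 ℕ.≤ m
    1≤m = ℕ.≤-trans (ℕ.*-mono-≤ {1} {8} {1} {k} (ℕ.s≤s ℕ.z≤n) 1≤k) 8k≤m
    Ci = N C i
    Ck = N C k
    M = m ℕ.^ c
    T = 32 ℕ.* (k ℕ.* k ℕ.* k) ℕ.* n

    round : bi * ℕ→ℚ Ck ≤ ℕ→ℚ 2 * (bk * ℕ→ℚ Ci)
    round = subst₂ℚ (binomQ-ℕ N k k≤N) (binomQ-ℕ N i (ℕ.≤-trans i≤k k≤N)) (binomQ-round-≤ {k} 2k≤x x≤N N≤x+1 i≤k)
      where
      subst₂ℚ : ∀ {a a′ b b′} → a ≡ a′ → b ≡ b′ → bi * a ≤ ℕ→ℚ 2 * (bk * b) → bi * a′ ≤ ℕ→ℚ 2 * (bk * b′)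
      subst₂ℚ refl refl le = le

    wp≤Bn : wp F m ℕ.≤ (N C (k ∸ c)) ℕ.* n
    wp≤Bn = ℕ→ℚ-cancel (begin
      ℕ→ℚ (wp F m)                            ≤⟨ wp≤ ⟩
      binomQ x (k ∸ c) * ℕ→ℚ n                ≤⟨ *-monoʳ-≤ (0≤ℕ→ℚ n) (binomQ-monoˡ {k} 2k≤x x≤N (ℕ.m∸n≤m k c)) ⟩
      binomQ (ℕ→ℚ N) (k ∸ c) * ℕ→ℚ n          ≡⟨ cong (_* ℕ→ℚ n) (binomQ-ℕ N (k ∸ c) (ℕ.≤-trans (ℕ.m∸n≤m k c) k≤N)) ⟩
      ℕ→ℚ (N C (k ∸ c)) * ℕ→ℚ n               ≡⟨ sym (ℕ→ℚ-* (N C (k ∸ c)) n) ⟩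
      ℕ→ℚ ((N C (k ∸ c)) ℕ.* n)               ∎)

    core : 2 ℕ.* f ℕ.* Ci ℕ.* M ℕ.≤ T ℕ.^ c ℕ.* Ck ℕ.* s
    core = shadowSize-bound F uniq uniform c′ m N i m≤n 8k≤m 2k≤N c<i i≤k f≤n^c wp≤Bn (2*½ {wp F m} {f} wp≤½)

    8k≤Q : ℕ→ℚ (8 ℕ.* k) ≤ Q
    8k≤Q = ≤-* (0≤ℕ→ℚ (8 ℕ.* k)) 1≤y
    1≤Q : 1ℚ ≤ Q
    1≤Q = ≤-trans (ℕ→ℚ-mono {1} {8 ℕ.* k} (ℕ.*-mono-≤ {1} {8} {1} {k} (ℕ.s≤s ℕ.z≤n) 1≤k)) 8k≤Q
    T≤ : ℕ→ℚ T ≤ Q * Q * Q * ℕ→ℚ m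
    -- From m ≥ 1 follows m + 1 ≤ 2m, hence n ≤ 2m/α in spite of the floor.
    T≤ = 32k³n≤Q³m k m n 1≤y (n≤ {2 ℕ.* m} (ℕ.+-mono-≤ 1≤m (ℕ.m≤m+n m 0)))

    3c≤c5 : c ℕ.* 3 ℕ.≤ c5
    3c≤c5 = exponent-bound c′ c5 2≤n n≤f (ℕ.≰⇒> λ le → ℕ.<-irrefl refl (c-least c′ le)) f⁵≤
    T^c≤ : ℕ→ℚ (T ℕ.^ c) ≤ Q ^ℚ c5 * ℕ→ℚ M
    T^c≤ = ^-≤-cube {Q} T m {c} {c5} 1≤Q T≤ 3c≤c5

  bound : Dec (8 ℕ.* k ℕ.≤ m) → bi * ℕ→ℚ f ≤ Q ^ℚ c5 * bk * ℕ→ℚ s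
  bound (yes 8k≤m) = large-m 8k≤m
  bound (no  8k≰m) = small-m (ℕ.≰⇒> 8k≰m)
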